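{- Let $s\ge0$ be an integer, $h\in\mathbb C\setminus\{0\}$, $q\in\mathbb C\setminus\{0\}$, and let $U,V$ satisfy $UV-qVU=hV^s$. Let $n\ge1$, let $\mathbf r=(r_1,\ldots,r_n)$ and $\mathbf s=(s_1,\ldots,s_n)$ be sequences of nonnegative integers, and let $H_{\mathbf r,\mathbf s}=V^{r_n}U^{s_n}\cdots V^{r_2}U^{s_2}V^{r_1}U^{s_1}$. Then $$H_{\mathbf r,\mathbf s}=\sum_{j_1=0}^{s_2}\sum_{j_2=0}^{s_3}\cdots\sum_{j_{n-1}=0}^{s_n}h^{j_1+\cdots+j_{n-1}}\left(\prod_{i=1}^{n-1}\Gamma_{q,s}\bigl[j_i,\;r_1+\cdots+r_i+(j_1+\cdots+j_{i-1})(s-1),\;s_{i+1}\bigr]\right)V^{r_1+\cdots+r_n+(j_1+\cdots+j_{n-1})(s-1)}U^{s_1+\cdots+s_n-(j_1+\cdots+j_{n-1})},$$ where $$\Gamma_{q,s}[j,r',s']=q^{r'(s'-j)}\genfrac{[}{]}{0pt}{}{s'}{j}_{q^{s-1}}\prod_{i=0}^{j-1}[r'+i(s-1)]_q .$$ (Terms in which the exponent of $V$ is negative have coefficient $0$ and are read as $0$.) Hence, for $s_1\le k\le|\mathbf s|$, $$S^{\mathbf r,\mathbf s}_{s,h,q}[k]=h^{|\mathbf s|-k}\sum_{j_1+\cdots+j_{n-1}=s_1+\cdots+s_n-k}\ \prod_{i=1}^{n-1}\Gamma_{q,s}\bigl[j_i,\;r_1+\cdots+r_i+(j_1+\cdots+j_{i-1})(s-1),\;s_{i+1}\bigr],$$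 the sum being over nonnegative integers $j_1,\ldots,j_{n-1}$.
   Context: For an integer $x$, $[x]_q=\frac{q^x-1}{q-1}$ if $q\ne1$ and $[x]_1=x$. $\genfrac{[}{]}{0pt}{}{n}{k}_p$ is the Gaussian ($p$-binomial) coefficient, understood as a polynomial in $p$ evaluated at the given value, and equal to $0$ if $k>n$. For a finite sequence, $|\cdot|$ denotes the sum of its entries. The numbers $S^{\mathbf r,\mathbf s}_{s,h,q}[k]$ are the normal ordering coefficients of $H_{\mathbf r,\mathbf s}$, i.e. in the algebra $\mathbb C\langle U,V\rangle/(UV-qVU-hV^s)$ (in which the monomials $V^iU^j$, $i,j\ge0$, form a basis) they are defined by $H_{\mathbf r,\mathbf s}=\sum_{k=s_1}^{|\mathbf s|}S^{\mathbf r,\mathbf s}_{s,h,q}[k]\,V^{|\mathbf r|-(|\mathbf s|-k)(1-s)}U^k$, with the coefficient taken to be $0$ when the exponent of $V$ is negative. Empty sums in arguments equal $0$, empty products equal $1$. -}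

module Defs where

open import Algebra.Apartness.Bundles using (HeytingField; HeytingCommutativeRing)
open import Algebra.Bundles using (CommutativeMonoid; CommutativeRing; Ring; Semiring)
open import Algebra.Morphism.Structures using (IsRingHomomorphism)
import Algebra.Definitions.RawMonoid as RawMonoidDefs
import Algebra.Definitions.RawSemiring as RawSemiringDefs
import Algebra.Properties.Ring as RingProperties
import Algebra.Solver.Ring.NaturalCoefficients.Default as Solver
open import Data.Fin.Base using (toℕ; suc)
open import Data.Integer.Base as ℤ using (ℤ; +_; -[1+_])
import Data.List.Base as List
import Data.Nat.ListAction as ListAction
open import Data.Nat.Base as ℕ using (ℕ; zero; suc; _∸_; _≤_)
open import Data.Product.Base using (_,_; proj₁)
open import Data.Sum.Base using (_⊎_; inj₁; inj₂)
open import Data.Vec.Base as Vec using (Vec; []; _∷_; lookup)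
open import Level using (_⊔_) renaming (suc to lsuc)
import Relation.Binary.Reasoning.Setoid as SetoidReasoning

-- x₁ + ⋯ + xᵢ
prefixSum : ∀ {n} → Vec ℕ n → ℕ → ℕ
prefixSum xs i = ListAction.sum (List.take i (Vec.toList xs))

module Sums {c ℓ} (M : CommutativeMonoid c ℓ) where
  open CommutativeMonoid M
  open RawMonoidDefs rawMonoid using (sum)

  -- ∑ of f k over a ≤ k ≤ b
  sumBetween : ℕ → ℕ → (ℕ → Carrier) → Carrier
  sumBetween a b f = sum {suc b ∸ a} (λ i → f (a ℕ.+ toℕ i))

  -- ∑_{j₁=0}^{b₁} ⋯ ∑_{jₘ=0}^{bₘ} f (j₁ , … , jₘ)
  nestedSum : ∀ {m} → Vec ℕ m → (Vec ℕ m → Carrier) → Carrier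
  nestedSum []       f = f []
  nestedSum (b ∷ bs) f = sumBetween 0 b (λ j → nestedSum bs (λ js → f (j ∷ js)))

  -- ∑ of f j over all j ∈ ℕᵐ with j₁ + ⋯ + jₘ = t
  sumOfTotal : ∀ m → ℕ → (Vec ℕ m → Carrier) → Carrier
  sumOfTotal zero    zero    f = f []
  sumOfTotal zero    (suc t) f = ε
  sumOfTotal (suc m) t       f =
    sumBetween 0 t (λ j → sumOfTotal m (t ∸ j) (λ js → f (j ∷ js)))

module Gaussian {c ℓ} (R : CommutativeRing c ℓ) where
  open CommutativeRing R
  open RawSemiringDefs (Semiring.rawSemiring semiring) using (_^_)
  open RingProperties ring using (x[y-z]≈xy-xz)
  open SetoidReasoning setoid

  -- The value at p of the Gaussian polynomial, by the q-Pascal rule. The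
  -- quotient formula, which is gauss-quotient below, cannot serve as the
  -- definition when p is a root of unity.
  gauss : Carrier → ℕ → ℕ → Carrier
  gauss p n       zero    = 1#
  gauss p zero    (suc k) = 0#
  gauss p (suc n) (suc k) = gauss p n k + p ^ suc k * gauss p n (suc k)

  -- (1 - pⁿ)(1 - pⁿ⁻¹)⋯(1 - pⁿ⁻ᵏ⁺¹); it vanishes for k > n.
  falling : Carrier → ℕ → ℕ → Carrier
  falling p n       zero    = 1#
  falling p zero    (suc k) = 0#
  falling p (suc n) (suc k) = (1# - p ^ suc n) * falling p n k

  private
    open Solver commutativeSemiring using (solve; _:+_; _:*_; _:=_; con)

    telescope : ∀ x y z → (x - y) + (y - z) ≈ x - z
    telescope x y z = begin
      (x - y) + (y - z)   ≈⟨ +-assoc x (- y) (y - z) ⟩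
      x + (- y + (y - z)) ≈⟨ +-congˡ (+-assoc (- y) y (- z)) ⟨
      x + (- y + y - z)   ≈⟨ +-congˡ (+-congʳ (-‿inverseˡ y)) ⟩
      x + (0# - z)        ≈⟨ +-congˡ (+-identityˡ (- z)) ⟩
      x - z               ∎

    falling-suc : ∀ p n k →
      p ^ suc k * falling p n (suc k) ≈ (p ^ suc k - p ^ suc n) * falling p n k
    falling-suc p zero zero =
      trans (zeroʳ _) (sym (trans (*-congʳ (-‿inverseʳ _)) (zeroˡ _)))
    falling-suc p zero (suc k) = trans (zeroʳ _) (sym (zeroʳ _))
    falling-suc p (suc n) zero = begin
      p * 1# * ((1# - b) * 1#)
        ≈⟨ solve 2 (λ p u → p :* con 1 :* (u :* con 1) := p :* u :* con 1) refl p (1# - b) ⟩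
      p * (1# - b) * 1#        ≈⟨ *-congʳ (x[y-z]≈xy-xz p 1# b) ⟩
      (p * 1# - p * b) * 1#    ∎
      where
      b = p ^ suc n
    falling-suc p (suc n) (suc k) = begin
      p * a * (u * f′)
        ≈⟨ solve 4 (λ p a u f → p :* a :* (u :* f) := p :* u :* (a :* f)) refl p a u f′ ⟩
      p * u * (a * f′)          ≈⟨ *-congˡ (falling-suc p n k) ⟩
      p * u * ((a - b) * f)
        ≈⟨ solve 4 (λ p v u f → p :* u :* (v :* f) := p :* v :* (u :* f)) refl p (a - b) u f ⟩
      p * (a - b) * (u * f)     ≈⟨ *-congʳ (x[y-z]≈xy-xz p a b) ⟩
      (p * a - p * b) * (u * f) ∎
      where
      a  = p ^ suc k
      b  = p ^ suc n
      u  = 1# - b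
      f  = falling p n k
      f′ = falling p n (suc k)

  gauss-quotient : ∀ p n k → gauss p n k * falling p k k ≈ falling p n k
  gauss-quotient p zero    zero    = *-identityˡ 1#
  gauss-quotient p (suc n) zero    = *-identityˡ 1#
  gauss-quotient p zero    (suc k) = zeroˡ _
  gauss-quotient p (suc n) (suc k) = begin
    (g + a * g′) * ((1# - a) * d)
      ≈⟨ solve 5 (λ g a g′ u d →
           (g :+ a :* g′) :* (u :* d) := u :* (g :* d) :+ a :* (g′ :* (u :* d)))
           refl g a g′ (1# - a) d ⟩
    (1# - a) * (g * d) + a * (g′ * ((1# - a) * d))
      ≈⟨ +-cong (*-congˡ (gauss-quotient p n k)) (*-congˡ (gauss-quotient p n (suc k))) ⟩
    (1# - a) * f + a * falling p n (suc k)
      ≈⟨ +-congˡ (falling-suc p n k) ⟩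
    (1# - a) * f + (a - b) * f
      ≈⟨ distribʳ f (1# - a) (a - b) ⟨
    (1# - a + (a - b)) * f
      ≈⟨ *-congʳ (telescope 1# a b) ⟩
    (1# - b) * f ∎
    where
    a  = p ^ suc k
    b  = p ^ suc n
    d  = falling p k k
    f  = falling p n k
    g  = gauss p n k
    g′ = gauss p n (suc k)

-- A Heyting field stands for ℂ, with apartness # as ≠. The case distinction
-- q = 1 or q ≠ 1, automatic classically, is passed as q≟1.
module QNumbers {c ℓ₁ ℓ₂} (K : HeytingField c ℓ₁ ℓ₂)
  (q : HeytingField.Carrier K)
  (q#0 : HeytingField._#_ K q (HeytingField.0# K))
  (q≟1 : HeytingField._≈_ K q (HeytingField.1# K) ⊎ HeytingField._#_ K q (HeytingField.1# K))
  where

  open HeytingField K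
    using (Carrier; _≈_; _#_; 1#; _*_; _-_; -_; heytingCommutativeRing; #⇒invertible)

  commutativeRing : CommutativeRing c ℓ₁
  commutativeRing = HeytingCommutativeRing.commutativeRing heytingCommutativeRing

  open CommutativeRing commutativeRing using (semiring; +-commutativeMonoid)
  open RawSemiringDefs (Semiring.rawSemiring semiring) using (product) renaming (_×_ to _·_)
  open RawSemiringDefs (Semiring.rawSemiring semiring) using (_^_) public
  open Sums +-commutativeMonoid using (sumOfTotal) public
  open Gaussian commutativeRing using (gauss)

  fromℤ : ℤ → Carrier
  fromℤ (+ n)    = n · 1#
  fromℤ -[1+ n ] = - (suc n · 1#)

  -- #⇒invertible gives an inverse of q - 0#, which equals q.
  q⁻¹ : Carrier
  q⁻¹ = proj₁ (#⇒invertible q#0)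

  q^ : ℤ → Carrier
  q^ (+ n)    = q ^ n
  q^ -[1+ n ] = q⁻¹ ^ suc n

  bracket : q ≈ 1# ⊎ q # 1# → ℤ → Carrier
  bracket (inj₁ _)   x = fromℤ x
  bracket (inj₂ q#1) x = (q^ x - 1#) * proj₁ (#⇒invertible q#1)

  [_] : ℤ → Carrier
  [_] = bracket q≟1

  Γ : ℕ → ℕ → ℤ → ℕ → Carrier
  Γ s j r′ s′ =
    q^ (r′ ℤ.* (+ s′ ℤ.- + j))
      * gauss (q^ (+ s ℤ.- + 1)) s′ j
      * product {j} (λ i → [ r′ ℤ.+ + toℕ i ℤ.* (+ s ℤ.- + 1) ])

  -- ∏_{i=1}^{n-1} Γ[jᵢ , r₁ + ⋯ + rᵢ + (j₁ + ⋯ + jᵢ₋₁)(s - 1) , sᵢ₊₁] for n = suc m.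
  -- The index i : Fin m counts from 0.
  ΓProduct : ∀ {m} → ℕ → Vec ℕ (suc m) → Vec ℕ (suc m) → Vec ℕ m → Carrier
  ΓProduct {m} s 𝐫 𝐬 𝐣 = product {m} λ i →
    Γ s (lookup 𝐣 i)
        (+ prefixSum 𝐫 (suc (toℕ i)) ℤ.+ + prefixSum 𝐣 (toℕ i) ℤ.* (+ s ℤ.- + 1))
        (lookup 𝐬 (suc i))

  coefficient : ∀ {m} → ℕ → Carrier → Vec ℕ (suc m) → Vec ℕ (suc m) → Vec ℕ m → Carrier
  coefficient s h 𝐫 𝐬 𝐣 = h ^ Vec.sum 𝐣 * ΓProduct s 𝐫 𝐬 𝐣

  -- r₁ + ⋯ + rₙ + (j₁ + ⋯ + jₙ₋₁)(s - 1)
  V-degree : ∀ {m} → ℕ → Vec ℕ (suc m) → Vec ℕ m → ℤ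
  V-degree s 𝐫 𝐣 = + Vec.sum 𝐫 ℤ.+ + Vec.sum 𝐣 ℤ.* (+ s ℤ.- + 1)

record AssociativeAlgebra {c ℓ₁} (R : CommutativeRing c ℓ₁) a ℓ
  : Set (c ⊔ ℓ₁ ⊔ lsuc (a ⊔ ℓ)) where
  field
    ring : Ring a ℓ
  open Ring ring public
  open RawSemiringDefs (Semiring.rawSemiring semiring) using (_^_) public
  open Sums +-commutativeMonoid using (sumBetween; nestedSum) public
  field
    ι                  : CommutativeRing.Carrier R → Carrier
    isRingHomomorphism : IsRingHomomorphism (CommutativeRing.rawRing R) rawRing ι
    ι-central          : ∀ k x → ι k * x ≈ x * ι k

module Words {c ℓ₁ a ℓ} {R : CommutativeRing c ℓ₁} (A : AssociativeAlgebra R a ℓ)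
  (U V : AssociativeAlgebra.Carrier A)
  where

  open AssociativeAlgebra A using (Carrier; _*_; _^_; 0#; 1#)

  -- V^{rₙ} U^{sₙ} ⋯ V^{r₁} U^{s₁}: the first entries are the rightmost factors.
  H : ∀ {n} → Vec ℕ n → Vec ℕ n → Carrier
  H []       []       = 1#
  H (r ∷ 𝐫) (s ∷ 𝐬) = H 𝐫 𝐬 * (V ^ r * U ^ s)

  -- Vᵉ Uᵏ, read as 0 when e is negative.
  monomial : ℤ → ℕ → Carrier
  monomial (+ e)    k = V ^ e * U ^ k
  monomial -[1+ _ ] k = 0#

-- The quotient algebra R⟨U , V⟩ / (UV - qVU - hVˢ)
module Presented {c ℓ} (R : CommutativeRing c ℓ)
  (s : ℕ) (h q : CommutativeRing.Carrier R)
  where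

  private module R = CommutativeRing R

  infix  8 ⊟_
  infixl 7 _⊠_
  infixl 6 _⊞_
  infix  4 _∼_

  data Term : Set c where
    𝐔 𝐕     : Term
    const   : R.Carrier → Term
    _⊞_ _⊠_ : Term → Term → Term
    ⊟_      : Term → Term

  _^ᵀ_ : Term → ℕ → Term
  t ^ᵀ zero  = const R.1#
  t ^ᵀ suc n = t ⊠ t ^ᵀ n

  -- The least congruence making Term an R-algebra in which the relation holds.
  data _∼_ : Term → Term → Set (c ⊔ ℓ) where
    ∼-refl  : ∀ {x} → x ∼ x
    ∼-sym   : ∀ {x y} → x ∼ y → y ∼ x
    ∼-trans : ∀ {x y z} → x ∼ y → y ∼ z → x ∼ z

    ⊞-cong : ∀ {x x′ y y′} → x ∼ x′ → y ∼ y′ → x ⊞ y ∼ x′ ⊞ y′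
    ⊠-cong : ∀ {x x′ y y′} → x ∼ x′ → y ∼ y′ → x ⊠ y ∼ x′ ⊠ y′
    ⊟-cong : ∀ {x x′} → x ∼ x′ → ⊟ x ∼ ⊟ x′

    ⊞-assoc     : ∀ x y z → (x ⊞ y) ⊞ z ∼ x ⊞ (y ⊞ z)
    ⊞-comm      : ∀ x y → x ⊞ y ∼ y ⊞ x
    ⊞-identityˡ : ∀ x → const R.0# ⊞ x ∼ x
    ⊟-inverseˡ  : ∀ x → ⊟ x ⊞ x ∼ const R.0#
    ⊠-assoc     : ∀ x y z → (x ⊠ y) ⊠ z ∼ x ⊠ (y ⊠ z)
    ⊠-identityˡ : ∀ x → const R.1# ⊠ x ∼ x
    ⊠-identityʳ : ∀ x → x ⊠ const R.1# ∼ x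
    distribˡ    : ∀ x y z → x ⊠ (y ⊞ z) ∼ x ⊠ y ⊞ x ⊠ z
    distribʳ    : ∀ x y z → (y ⊞ z) ⊠ x ∼ y ⊠ x ⊞ z ⊠ x

    const-cong    : ∀ {k l} → k R.≈ l → const k ∼ const l
    const-⊞       : ∀ k l → const (k R.+ l) ∼ const k ⊞ const l
    const-⊠       : ∀ k l → const (k R.* l) ∼ const k ⊠ const l
    const-⊟       : ∀ k → const (R.- k) ∼ ⊟ const k
    const-central : ∀ k x → const k ⊠ x ∼ x ⊠ const k

    relation : 𝐔 ⊠ 𝐕 ⊞ ⊟ (const q ⊠ (𝐕 ⊠ 𝐔)) ∼ const h ⊠ 𝐕 ^ᵀ s

  algebra : AssociativeAlgebra R c (c ⊔ ℓ)
  algebra = record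
    { ring = record
      { Carrier = Term
      ; _≈_ = _∼_
      ; _+_ = _⊞_
      ; _*_ = _⊠_
      ; -_ = ⊟_
      ; 0# = const R.0#
      ; 1# = const R.1#
      ; isRing = record
        { +-isAbelianGroup = record
          { isGroup = record
            { isMonoid = record
              { isSemigroup = record
                { isMagma = record
                  { isEquivalence = record { refl = ∼-refl ; sym = ∼-sym ; trans = ∼-trans }
                  ; ∙-cong = ⊞-cong
                  }
                ; assoc = ⊞-assoc
                }
              ; identity = ⊞-identityˡ , λ x → ∼-trans (⊞-comm x _) (⊞-identityˡ x)
              }
            ; inverse = ⊟-inverseˡ , λ x → ∼-trans (⊞-comm x _) (⊟-inverseˡ x)
            ; ⁻¹-cong = ⊟-cong
            }
          ; comm = ⊞-comm
          }
        ; *-cong = ⊠-cong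
        ; *-assoc = ⊠-assoc
        ; *-identity = ⊠-identityˡ , ⊠-identityʳ
        ; distrib = distribˡ , distribʳ
        }
      }
    ; ι = const
    ; isRingHomomorphism = record
      { isSemiringHomomorphism = record
        { isNearSemiringHomomorphism = record
          { +-isMonoidHomomorphism = record
            { isMagmaHomomorphism = record
              { isRelHomomorphism = record { cong = const-cong }
              ; homo = const-⊞
              }
            ; ε-homo = ∼-refl
            }
          ; *-homo = const-⊠
          }
        ; 1#-homo = ∼-refl
        }
      ; -‿homo = const-⊟
      }
    ; ι-central = const-central
    }

module NormalOrdering {c ℓ} (R : CommutativeRing c ℓ)
  (s : ℕ) (h q : CommutativeRing.Carrier R) {n : ℕ} (𝐫 𝐬 : Vec ℕ (suc n))
  where

  private module R = CommutativeRing R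
  open Presented R s h q using (algebra; 𝐔; 𝐕)
  private module W = AssociativeAlgebra algebra
  open Words algebra 𝐔 𝐕 using (H; monomial)

  -- |𝐫| - (|𝐬| - k)(1 - s)
  V-exponent : ℕ → ℤ
  V-exponent k = + Vec.sum 𝐫 ℤ.- (+ Vec.sum 𝐬 ℤ.- + k) ℤ.* (+ 1 ℤ.- + s)

  record AreNormalOrderingCoefficients (S : ℕ → R.Carrier) : Set (c ⊔ ℓ) where
    field
      expansion : H 𝐫 𝐬 W.≈
        W.sumBetween (Vec.head 𝐬) (Vec.sum 𝐬) (λ k → W.ι (S k) W.* monomial (V-exponent k) k)
      vanishing : ∀ k → Vec.head 𝐬 ≤ k → k ≤ Vec.sum 𝐬 →
        V-exponent k ℤ.< + 0 → S k R.≈ R.0#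

{-# OPTIONS --safe #-}
module Submission where

open import Defs
open import Algebra.Apartness.Bundles using (HeytingField)
open import Algebra.Bundles using (CommutativeMonoid; CommutativeRing)
open import Algebra.Morphism.Structures using (IsRingHomomorphism)
import Algebra.Properties.CommutativeMonoid.Sum as CommutativeMonoidSum
import Algebra.Properties.CommutativeSemigroup as CommutativeSemigroupProperties
import Algebra.Properties.Ring as RingProperties
import Algebra.Properties.Semiring.Exp as Exp
import Algebra.Solver.Ring.NaturalCoefficients.Default as Solver
open import Data.Fin.Base using (Fin; toℕ; fromℕ<) renaming (zero to fzero; suc to fsuc)
open import Data.Fin.Properties using (toℕ-fromℕ<)
open import Data.Integer.Base as ℤ using (ℤ; +_; -[1+_])
import Data.Integer.Properties as ℤₚ
import Data.Integer.Tactic.RingSolver as ℤ-Solver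
open import Data.Nat.Base as ℕ using (ℕ; zero; suc; _∸_; _≤_; _<_; z≤n; s≤s)
import Data.Nat.Properties as ℕₚ
open import Data.Product.Base using (_×_; ∃; _,_; proj₁; proj₂)
open import Data.Sum.Base using (_⊎_; inj₁; inj₂)
open import Data.Vec.Base using (Vec; []; _∷_; head; tail; sum; lookup)
open import Data.Vec.Relation.Binary.Pointwise.Inductive using (Pointwise)
open import Function.Base using (_∘_)
open import Relation.Binary.PropositionalEquality.Core as ≡ using (_≡_)
open import Relation.Binary.PropositionalEquality.Properties using (module ≡-Reasoning)
import Relation.Binary.Reasoning.Setoid as SetoidReasoning
open import Relation.Nullary.Decidable using (yes; no)

-- The relation gives U V^e = q^e V^e U + h [e] V^(e+s-1), and induction on t,
-- by the q-Pascal rule, gives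
--   U^t V^e = ∑_j h^j Γ[j , e , t] V^(e + j(s-1)) U^(t-j).
-- Applying this at the right end of H merges the two rightmost blocks into one,
-- and induction on the number of blocks gives the expansion. When an exponent
-- e + j(s-1) is negative, so that s = 0 and j > e, the factor [0] of Γ vanishes.
-- The normal ordering coefficients are then obtained by grouping the terms by
-- j₁ + ⋯ + jₙ₋₁; terms with some jᵢ > sᵢ₊₁ vanish with the Gaussian coefficient.
-- They are unique since the monomials V^i U^j are linearly independent.

-- Working from the right end is what produces the middle argument of each Γ. Once `V ^ e` has
-- crossed `U ^ t` with `j` contractions (uses of the term h V^s), it joins the next `V ^ r`, so the
-- power of V to be moved next is `r + e + j(s-1)`; the sum r₁ + ⋯ + rᵢ + (j₁ + ⋯ + jᵢ₋₁)(s-1) is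
-- this running exponent. The base q^(s-1) of the Gaussian coefficient arises because a contraction
-- shifts the exponent of V by s - 1 and so multiplies by q^(s-1) the factor that each later U picks
-- up in passing.
--
-- The obstacle is s = 0. Exponents of V may then become negative, so they are kept in ℤ, while
-- actual powers need natural exponents. The inductions split on the sign of `e + j(s-1)`: in the
-- negative case no shorter word exists, and the vanishing of Γ has to close the argument.
--
-- For uniqueness it suffices to read off the power of U, since a normal ordering expansion has a
-- single monomial for each `k`.

-- Arithmetic of index vectors.

exceeding-entry : ∀ {m} (bs 𝐣 : Vec ℕ m) → sum bs < sum 𝐣 → ∃ λ i → lookup bs i < lookup 𝐣 i
exceeding-entry []       []      ()
exceeding-entry (b ∷ bs) (j ∷ 𝐣) lt with b ℕₚ.<? j
... | yes b<j = fzero , b<j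
... | no  b≮j with exceeding-entry bs 𝐣
                     (ℕₚ.+-cancelˡ-< b _ _ (ℕₚ.<-≤-trans lt (ℕₚ.+-monoˡ-≤ _ (ℕₚ.≮⇒≥ b≮j))))
...   | i , lt′ = fsuc i , lt′

-- Compares the exponent of U computed in the merged word, whose first block has `t ∸ j + k` factors
-- U, with the one in the original word. Only `j ≤ t` has to be known, because successive truncated
-- subtractions compose.
remaining-degree : ∀ {j t} k S J → j ≤ t → (t ∸ j ℕ.+ k ℕ.+ S) ∸ J ≡ (k ℕ.+ (t ℕ.+ S)) ∸ (j ℕ.+ J)
remaining-degree {j} {t} k S J j≤t = begin
  (t ∸ j ℕ.+ k ℕ.+ S) ∸ J         ≡⟨ ≡.cong (_∸ J) (ℕₚ.+-assoc (t ∸ j) k S) ⟩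
  (t ∸ j ℕ.+ (k ℕ.+ S)) ∸ J       ≡⟨ ≡.cong (_∸ J) (ℕₚ.+-∸-comm (k ℕ.+ S) j≤t) ⟨
  (t ℕ.+ (k ℕ.+ S)) ∸ j ∸ J       ≡⟨ ℕₚ.∸-+-assoc (t ℕ.+ (k ℕ.+ S)) j J ⟩
  (t ℕ.+ (k ℕ.+ S)) ∸ (j ℕ.+ J)   ≡⟨ ≡.cong (_∸ (j ℕ.+ J)) (x∙yz≈y∙xz t k S) ⟩
  (k ℕ.+ (t ℕ.+ S)) ∸ (j ℕ.+ J)   ∎
  where
  open ≡-Reasoning
  open CommutativeSemigroupProperties ℕₚ.+-commutativeSemigroup using (x∙yz≈y∙xz)

-- Finite sums in a commutative monoid.

module FiniteSums {c ℓ} (M : CommutativeMonoid c ℓ) where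
  open CommutativeMonoid M
  open CommutativeMonoidSum M
    using (sum-cong-≋; ∑-distrib-+; sum-replicate-zero)
    renaming (sum to ∑)
  open Sums M
  open SetoidReasoning setoid

  ∑< : ℕ → (ℕ → Carrier) → Carrier
  ∑< n f = ∑ {n} (λ i → f (toℕ i))

  ∑<-cong : ∀ n {f g} → (∀ i → i < n → f i ≈ g i) → ∑< n f ≈ ∑< n g
  ∑<-cong zero    eq = refl
  ∑<-cong (suc n) eq = ∙-cong (eq 0 (s≤s z≤n)) (∑<-cong n λ i i<n → eq (suc i) (s≤s i<n))

  ∑<-zero : ∀ n {f} → (∀ i → i < n → f i ≈ ε) → ∑< n f ≈ ε
  ∑<-zero n eq = trans (∑<-cong n eq) (sum-replicate-zero n)

  ∑<-distrib : ∀ n f g → ∑< n (λ i → f i ∙ g i) ≈ ∑< n f ∙ ∑< n g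
  ∑<-distrib n f g = ∑-distrib-+ {n} (λ i → f (toℕ i)) (λ i → g (toℕ i))

  ∑<-last : ∀ n f → ∑< (suc n) f ≈ ∑< n f ∙ f n
  ∑<-last zero    f = trans (identityʳ _) (sym (identityˡ _))
  ∑<-last (suc n) f = trans (∙-congˡ (∑<-last n (f ∘ suc))) (sym (assoc _ _ _))

  ∑<-reverse : ∀ n f → ∑< n f ≈ ∑< n (λ i → f (n ∸ suc i))
  ∑<-reverse zero    f = refl
  ∑<-reverse (suc n) f = begin
    ∑< (suc n) f                       ≈⟨ ∑<-last n f ⟩
    ∑< n f ∙ f n                       ≈⟨ comm _ _ ⟩
    f n ∙ ∑< n f                       ≈⟨ ∙-congˡ (∑<-reverse n f) ⟩
    f n ∙ ∑< n (λ i → f (n ∸ suc i))   ∎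

  ∑<-truncate : ∀ {m n f} → m ≤ n → (∀ i → m ≤ i → f i ≈ ε) → ∑< n f ≈ ∑< m f
  ∑<-truncate {n = n} z≤n       eq = ∑<-zero n λ i _ → eq i z≤n
  ∑<-truncate         (s≤s m≤n) eq = ∙-congˡ (∑<-truncate m≤n λ i m≤i → eq (suc i) (s≤s m≤i))

  -- Both sides run over the pairs `(j , u)` with `j + u < n`, grouped by total on the left and by
  -- `j` on the right. The induction splits off the row `j = 0`; what remains on the left is the
  -- triangle of the shifted function.
  ∑<-triangle : ∀ n (g : ℕ → ℕ → Carrier) →
    ∑< n (λ t → ∑< (suc t) (λ j → g j (t ∸ j))) ≈ ∑< n (λ j → ∑< (n ∸ j) (g j))
  ∑<-triangle zero    g = refl
  ∑<-triangle (suc n) g = begin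
    (g 0 0 ∙ ε) ∙ ∑< n (λ t → g 0 (suc t) ∙ ∑< (suc t) (λ j → g (suc j) (t ∸ j)))
      ≈⟨ ∙-cong (identityʳ _)
           (∑<-distrib n (g 0 ∘ suc) (λ t → ∑< (suc t) (λ j → g (suc j) (t ∸ j)))) ⟩
    g 0 0 ∙ (∑< n (g 0 ∘ suc) ∙ ∑< n (λ t → ∑< (suc t) (λ j → g (suc j) (t ∸ j))))
      ≈⟨ assoc _ _ _ ⟨
    (g 0 0 ∙ ∑< n (g 0 ∘ suc)) ∙ ∑< n (λ t → ∑< (suc t) (λ j → g (suc j) (t ∸ j)))
      ≈⟨ ∙-congˡ (∑<-triangle n (g ∘ suc)) ⟩
    (g 0 0 ∙ ∑< n (g 0 ∘ suc)) ∙ ∑< n (λ j → ∑< (n ∸ j) (g (suc j))) ∎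

  nestedSum-cong : ∀ {m} (bs : Vec ℕ m) {f g} → (∀ 𝐣 → f 𝐣 ≈ g 𝐣) → nestedSum bs f ≈ nestedSum bs g
  nestedSum-cong []       eq = eq []
  nestedSum-cong (b ∷ bs) eq = ∑<-cong (suc b) λ j _ → nestedSum-cong bs λ 𝐣 → eq (j ∷ 𝐣)

  nestedSum-zero : ∀ {m} (bs : Vec ℕ m) {f} → (∀ 𝐣 → f 𝐣 ≈ ε) → nestedSum bs f ≈ ε
  nestedSum-zero []       eq = eq []
  nestedSum-zero (b ∷ bs) eq = ∑<-zero (suc b) λ j _ → nestedSum-zero bs λ 𝐣 → eq (j ∷ 𝐣)

  sumOfTotal-cong : ∀ m t {f g} → (∀ 𝐣 → sum 𝐣 ≡ t → f 𝐣 ≈ g 𝐣) → sumOfTotal m t f ≈ sumOfTotal m t g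
  sumOfTotal-cong zero    zero    eq = eq [] ≡.refl
  sumOfTotal-cong zero    (suc t) eq = refl
  sumOfTotal-cong (suc m) t       eq = ∑<-cong (suc t) λ j j<1+t →
    sumOfTotal-cong m (t ∸ j) λ 𝐣 sum≡ →
      eq (j ∷ 𝐣) (≡.trans (≡.cong (j ℕ.+_) sum≡) (ℕₚ.m+[n∸m]≡n (ℕₚ.≤-pred j<1+t)))

  sumOfTotal-zero : ∀ m t {f} → (∀ 𝐣 → sum 𝐣 ≡ t → f 𝐣 ≈ ε) → sumOfTotal m t f ≈ ε
  sumOfTotal-zero m t eq = trans (sumOfTotal-cong m t eq) (zeros m t)
    where
    zeros : ∀ m t → sumOfTotal m t (λ _ → ε) ≈ ε
    zeros zero    zero    = refl
    zeros zero    (suc t) = refl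
    zeros (suc m) t       = ∑<-zero (suc t) λ j _ → zeros m (t ∸ j)

  -- The simplex of vectors with total at most `sum bs` contains the box. Each of its further points
  -- has an entry beyond its bound, where `f` vanishes.
  nestedSum-by-total : ∀ {m} (bs : Vec ℕ m) f →
    (∀ 𝐣 i → lookup bs i < lookup 𝐣 i → f 𝐣 ≈ ε) →
    nestedSum bs f ≈ ∑< (suc (sum bs)) (λ t → sumOfTotal m t f)
  nestedSum-by-total []                 f f≈ε = sym (identityʳ _)
  nestedSum-by-total {suc m} (b ∷ bs) f f≈ε = sym (begin
    ∑< (suc B) (λ t → ∑< (suc t) (λ j → T j (t ∸ j)))
      ≈⟨ ∑<-triangle (suc B) T ⟩
    ∑< (suc B) (λ j → ∑< (suc B ∸ j) (T j))
      ≈⟨ ∑<-truncate (s≤s (ℕₚ.m≤m+n b (sum bs))) (λ j b<j → ∑<-zero (suc B ∸ j) λ u _ →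
           sumOfTotal-zero m u {λ 𝐣 → f (j ∷ 𝐣)} λ 𝐣 _ → f≈ε (j ∷ 𝐣) fzero b<j) ⟩
    ∑< (suc b) (λ j → ∑< (suc B ∸ j) (T j))
      -- The inner range reaches up to `B ∸ j`, which is at least `sum bs`. A total beyond `sum bs`
      -- forces some entry of `𝐣` past its bound.
      ≈⟨ ∑<-cong (suc b) (λ j j<1+b → ∑<-truncate (bound (ℕₚ.≤-pred j<1+b)) λ u lt →
           sumOfTotal-zero m u {λ 𝐣 → f (j ∷ 𝐣)} λ { 𝐣 ≡.refl →
             let i , lt′ = exceeding-entry bs 𝐣 lt in f≈ε (j ∷ 𝐣) (fsuc i) lt′ }) ⟩
    ∑< (suc b) (λ j → ∑< (suc (sum bs)) (T j))
      ≈⟨ ∑<-cong (suc b) (λ j _ → nestedSum-by-total bs (λ 𝐣 → f (j ∷ 𝐣)) λ 𝐣 i → f≈ε (j ∷ 𝐣) (fsuc i)) ⟨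
    ∑< (suc b) (λ j → nestedSum bs (λ 𝐣 → f (j ∷ 𝐣))) ∎)
    where
    B = b ℕ.+ sum bs
    T : ℕ → ℕ → Carrier
    T j u = sumOfTotal m u (λ 𝐣 → f (j ∷ 𝐣))
    bound : ∀ {j} → j ≤ b → suc (sum bs) ≤ suc B ∸ j
    bound j≤b = ℕₚ.m+n≤o⇒m≤o∸n (suc (sum bs))
      (s≤s (ℕₚ.≤-trans (ℕₚ.+-monoʳ-≤ (sum bs) j≤b) (ℕₚ.≤-reflexive (ℕₚ.+-comm (sum bs) b))))

-- Additive maps commute with these sums.

module AdditiveMaps {c₁ ℓ₁ c₂ ℓ₂} (M : CommutativeMonoid c₁ ℓ₁) (N : CommutativeMonoid c₂ ℓ₂)
  (φ : CommutativeMonoid.Carrier M → CommutativeMonoid.Carrier N)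
  (φ-ε : CommutativeMonoid._≈_ N (φ (CommutativeMonoid.ε M)) (CommutativeMonoid.ε N))
  (φ-∙ : ∀ x y → CommutativeMonoid._≈_ N (φ (CommutativeMonoid._∙_ M x y))
                                         (CommutativeMonoid._∙_ N (φ x) (φ y)))
  where

  private
    module M = CommutativeMonoid M
    module N = CommutativeMonoid N
    module ΣM = Sums M
    module ΣN = Sums N
    module FM = FiniteSums M
    module FN = FiniteSums N

  ∑<-map : ∀ n f → φ (FM.∑< n f) N.≈ FN.∑< n (φ ∘ f)
  ∑<-map zero    f = φ-ε
  ∑<-map (suc n) f = N.trans (φ-∙ _ _) (N.∙-congˡ (∑<-map n (f ∘ suc)))

  nestedSum-map : ∀ {m} (bs : Vec ℕ m) f → φ (ΣM.nestedSum bs f) N.≈ ΣN.nestedSum bs (φ ∘ f)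
  nestedSum-map []       f = N.refl
  nestedSum-map (b ∷ bs) f =
    N.trans (∑<-map (suc b) λ j → ΣM.nestedSum bs (λ 𝐣 → f (j ∷ 𝐣)))
            (FN.∑<-cong (suc b) λ j _ → nestedSum-map bs λ 𝐣 → f (j ∷ 𝐣))

  sumOfTotal-map : ∀ m t f → φ (ΣM.sumOfTotal m t f) N.≈ ΣN.sumOfTotal m t (φ ∘ f)
  sumOfTotal-map zero    zero    f = N.refl
  sumOfTotal-map zero    (suc t) f = φ-ε
  sumOfTotal-map (suc m) t       f =
    N.trans (∑<-map (suc t) λ j → ΣM.sumOfTotal m (t ∸ j) (λ 𝐣 → f (j ∷ 𝐣)))
            (FN.∑<-cong (suc t) λ j _ → sumOfTotal-map m (t ∸ j) λ 𝐣 → f (j ∷ 𝐣))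

-- Zeros of Gaussian coefficients.

module GaussianProperties {c ℓ} (R : CommutativeRing c ℓ) where
  open CommutativeRing R
  open Gaussian R using (gauss)

  gauss-vanishes : ∀ p {n k} → n < k → gauss p n k ≈ 0#
  gauss-vanishes p {zero}  {suc k} _         = refl
  gauss-vanishes p {suc n} {suc k} (s≤s n<k) =
    trans (+-cong (gauss-vanishes p n<k) (*-congˡ (gauss-vanishes p (ℕₚ.m<n⇒m<1+n n<k))))
          (trans (+-identityˡ _) (zeroʳ _))

-- Integer powers of q, q-numbers, and the recurrence and zeros of Γ.

module QNumberProperties {c ℓ₁ ℓ₂} (K : HeytingField c ℓ₁ ℓ₂)
  (q : HeytingField.Carrier K)
  (q#0 : HeytingField._#_ K q (HeytingField.0# K))
  (q≟1 : HeytingField._≈_ K q (HeytingField.1# K) ⊎ HeytingField._#_ K q (HeytingField.1# K))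
  where

  open QNumbers K q q#0 q≟1 public
  open HeytingField K using (#⇒invertible)
  open CommutativeRing commutativeRing
  open Gaussian commutativeRing using (gauss)
  open GaussianProperties commutativeRing
  open Exp semiring using (^-homo-*)
  open RingProperties ring using (-0#≈0#)
  open Solver commutativeSemiring using (solve; _:+_; _:*_; _:=_; con)
  open SetoidReasoning setoid
  private
    module ∏ = FiniteSums *-commutativeMonoid
    open ∏ using () renaming (∑< to ∏<; ∑<-last to ∏<-last)
    open CommutativeMonoidSum *-commutativeMonoid using () renaming (sum to product; sum-cong-≋ to product-cong)

  q*q⁻¹ : q * q⁻¹ ≈ 1#
  q*q⁻¹ = begin
    q * q⁻¹        ≈⟨ *-congʳ (trans (+-congˡ -0#≈0#) (+-identityʳ q)) ⟨
    (q - 0#) * q⁻¹ ≈⟨ proj₂ (proj₂ (#⇒invertible q#0)) ⟩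
    1#             ∎

  q⁻¹*q : ∀ x → q⁻¹ * (q * x) ≈ x
  q⁻¹*q x = begin
    q⁻¹ * (q * x) ≈⟨ solve 3 (λ a b x → a :* (b :* x) := (b :* a) :* x) refl q⁻¹ q x ⟩
    q * q⁻¹ * x   ≈⟨ *-congʳ q*q⁻¹ ⟩
    1# * x        ≈⟨ *-identityˡ x ⟩
    x             ∎

  q*q⁻¹* : ∀ x → q * (q⁻¹ * x) ≈ x
  q*q⁻¹* x = begin
    q * (q⁻¹ * x) ≈⟨ *-assoc q q⁻¹ x ⟨
    q * q⁻¹ * x   ≈⟨ *-congʳ q*q⁻¹ ⟩
    1# * x        ≈⟨ *-identityˡ x ⟩
    x             ∎

  q^-cong : ∀ {x y} → x ≡ y → q^ x ≈ q^ y
  q^-cong ≡.refl = refl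

  q^-suc : ∀ x → q^ (+ 1 ℤ.+ x) ≈ q * q^ x
  q^-suc (+ n)        = refl
  q^-suc -[1+ zero ]  = sym (q*q⁻¹* 1#)
  q^-suc -[1+ suc n ] = sym (q*q⁻¹* _)

  q^-pred : ∀ x → q^ (-[1+ 0 ] ℤ.+ x) ≈ q⁻¹ * q^ x
  q^-pred x = begin
    q^ (-[1+ 0 ] ℤ.+ x)                        ≈⟨ q⁻¹*q _ ⟨
    q⁻¹ * (q * q^ (-[1+ 0 ] ℤ.+ x))            ≈⟨ *-congˡ (q^-suc (-[1+ 0 ] ℤ.+ x)) ⟨
    q⁻¹ * q^ (+ 1 ℤ.+ (-[1+ 0 ] ℤ.+ x))        ≈⟨ *-congˡ (q^-cong (cancel x)) ⟩
    q⁻¹ * q^ x                                 ∎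
    where
    cancel : ∀ x → + 1 ℤ.+ (-[1+ 0 ] ℤ.+ x) ≡ x
    cancel = ℤ-Solver.solve-∀

  q^-+ : ∀ x y → q^ (x ℤ.+ y) ≈ q^ x * q^ y
  q^-+ (+ zero) y = trans (q^-cong (ℤₚ.+-identityˡ y)) (sym (*-identityˡ _))
  q^-+ (+ suc n) y = begin
    q^ (+ suc n ℤ.+ y)         ≈⟨ q^-cong (ℤₚ.+-assoc (+ 1) (+ n) y) ⟩
    q^ (+ 1 ℤ.+ (+ n ℤ.+ y))   ≈⟨ q^-suc (+ n ℤ.+ y) ⟩
    q * q^ (+ n ℤ.+ y)         ≈⟨ *-congˡ (q^-+ (+ n) y) ⟩
    q * (q ^ n * q^ y)         ≈⟨ *-assoc _ _ _ ⟨
    q * q ^ n * q^ y           ∎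
  q^-+ -[1+ zero ] y = trans (q^-pred y) (*-congʳ (sym (*-identityʳ q⁻¹)))
  q^-+ -[1+ suc n ] y = begin
    q^ (-[1+ suc n ] ℤ.+ y)              ≈⟨ q^-cong (ℤₚ.+-assoc -[1+ 0 ] -[1+ n ] y) ⟩
    q^ (-[1+ 0 ] ℤ.+ (-[1+ n ] ℤ.+ y))   ≈⟨ q^-pred (-[1+ n ] ℤ.+ y) ⟩
    q⁻¹ * q^ (-[1+ n ] ℤ.+ y)            ≈⟨ *-congˡ (q^-+ -[1+ n ] y) ⟩
    q⁻¹ * (q^ -[1+ n ] * q^ y)           ≈⟨ *-assoc _ _ _ ⟨
    q⁻¹ * q^ -[1+ n ] * q^ y             ∎

  q^-* : ∀ x n → q^ (+ n ℤ.* x) ≈ q^ x ^ n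
  q^-* x zero    = q^-cong (ℤₚ.*-zeroˡ x)
  q^-* x (suc n) = begin
    q^ (+ suc n ℤ.* x)       ≈⟨ q^-cong (ℤₚ.suc-* (+ n) x) ⟩
    q^ (x ℤ.+ + n ℤ.* x)     ≈⟨ q^-+ x (+ n ℤ.* x) ⟩
    q^ x * q^ (+ n ℤ.* x)    ≈⟨ *-congˡ (q^-* x n) ⟩
    q^ x * q^ x ^ n          ∎

  bracket-zero : ∀ d → bracket d (+ 0) ≈ 0#
  bracket-zero (inj₁ _) = refl
  bracket-zero (inj₂ _) = trans (*-congʳ (-‿inverseʳ 1#)) (zeroˡ _)

  bracket-suc : ∀ d n → bracket d (+ suc n) ≈ q * bracket d (+ n) + 1#
  bracket-suc (inj₁ q≈1) n = begin
    1# + fromℤ (+ n)         ≈⟨ +-comm _ _ ⟩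
    fromℤ (+ n) + 1#         ≈⟨ +-congʳ (*-identityˡ _) ⟨
    1# * fromℤ (+ n) + 1#    ≈⟨ +-congʳ (*-congʳ q≈1) ⟨
    q * fromℤ (+ n) + 1#     ∎
  bracket-suc (inj₂ q#1) n = begin
    (q * x + m) * i                          ≈⟨ +-identityʳ _ ⟨
    (q * x + m) * i + 0#
      -- The zero `q * i * (1# + m)` supplies both missing terms: `q * m * i` completes `q * [ n ]`,
      -- and `q * i` completes `(q + m) * i`, which is 1 by the choice of `i`.
      ≈⟨ +-congˡ (trans (*-congˡ (-‿inverseʳ 1#)) (zeroʳ _)) ⟨
    (q * x + m) * i + q * i * (1# + m)
      ≈⟨ solve 4 (λ q x m i → (q :* x :+ m) :* i :+ q :* i :* (con 1 :+ m)
                            := q :* ((x :+ m) :* i) :+ (q :+ m) :* i) refl q x m i ⟩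
    q * ((x + m) * i) + (q + m) * i          ≈⟨ +-congˡ (proj₂ (proj₂ (#⇒invertible q#1))) ⟩
    q * ((x + m) * i) + 1#                   ∎
    where
    x = q ^ n
    m = - 1#
    i = proj₁ (#⇒invertible q#1)

  [0]≈0 : [ + 0 ] ≈ 0#
  [0]≈0 = bracket-zero q≟1

  [suc] : ∀ n → [ + suc n ] ≈ q * [ + n ] + 1#
  [suc] = bracket-suc q≟1

  [-]-cong : ∀ {x y} → x ≡ y → [ x ] ≈ [ y ]
  [-]-cong ≡.refl = refl

  product-zero : ∀ {m} (f : Fin m → Carrier) i → f i ≈ 0# → product f ≈ 0#
  product-zero f fzero    eq = trans (*-congʳ eq) (zeroˡ _)
  product-zero f (fsuc i) eq = trans (*-congˡ (product-zero (f ∘ fsuc) i eq)) (zeroʳ _)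

  Γ-cong : ∀ s j {x y} s′ → x ≡ y → Γ s j x s′ ≈ Γ s j y s′
  Γ-cong s j s′ ≡.refl = refl

  Γ-above : ∀ s {j} x {s′} → s′ < j → Γ s j x s′ ≈ 0#
  Γ-above s {j} x {s′} s′<j = begin
    Γ s j x s′ ≈⟨ *-congʳ (*-congˡ (gauss-vanishes _ s′<j)) ⟩
    _ * 0# * _ ≈⟨ *-congʳ (zeroʳ _) ⟩
    0# * _     ≈⟨ zeroˡ _ ⟩
    0#         ∎

  Γ-suc-zero : ∀ s x s′ → Γ s 0 x (suc s′) ≈ Γ s 0 x s′ * q^ (x ℤ.+ + 0 ℤ.* (+ s ℤ.- + 1))
  Γ-suc-zero s x s′ = begin
    q^ (x ℤ.* (+ suc s′ ℤ.- + 0)) * 1# * 1#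
      ≈⟨ *-congʳ (*-congʳ (trans (q^-cong (split x (+ s′) (+ s)))
           (q^-+ (x ℤ.* (+ s′ ℤ.- + 0)) (x ℤ.+ + 0 ℤ.* (+ s ℤ.- + 1))))) ⟩
    q^ (x ℤ.* (+ s′ ℤ.- + 0)) * Z * 1# * 1#
      ≈⟨ solve 2 (λ a z → a :* z :* con 1 :* con 1 := a :* con 1 :* con 1 :* z) refl _ Z ⟩
    q^ (x ℤ.* (+ s′ ℤ.- + 0)) * 1# * 1# * Z ∎
    where
    Z = q^ (x ℤ.+ + 0 ℤ.* (+ s ℤ.- + 1))
    split : ∀ x a s → x ℤ.* (+ 1 ℤ.+ a ℤ.- + 0) ≡ x ℤ.* (a ℤ.- + 0) ℤ.+ (x ℤ.+ + 0 ℤ.* (s ℤ.- + 1))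
    split = ℤ-Solver.solve-∀

  -- One more U acts from the left. Either it passes the current power of V, contributing q to that
  -- exponent, or it contracts, contributing the q-number of the exponent. The two terms match those
  -- of the q-Pascal rule with p = q^(s-1): after the factor `q^` of the prefix has lost one `x`,
  -- the weight `p ^ suc j` is exactly what completes it to q^(x + (j+1)(s-1)).
  Γ-suc-suc : ∀ s j x s′ →
    Γ s (suc j) x (suc s′) ≈
      Γ s (suc j) x s′ * q^ (x ℤ.+ + suc j ℤ.* (+ s ℤ.- + 1)) + Γ s j x s′ * [ x ℤ.+ + j ℤ.* (+ s ℤ.- + 1) ]
  Γ-suc-suc s j x s′ = begin
    q^ (x ℤ.* (+ suc s′ ℤ.- + suc j)) * (G + pʲ * G′) * ∏< (suc j) f
      ≈⟨ *-cong (*-congʳ (q^-cong (shift x (+ s′) (+ j)))) (∏<-last j f) ⟩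
    A * (G + pʲ * G′) * (P * f j)
      ≈⟨ solve 6 (λ a g p g′ P b → a :* (g :+ p :* g′) :* (P :* b)
                                := (a :* p) :* (g′ :* (P :* b)) :+ a :* g :* P :* b) refl A G pʲ G′ P (f j) ⟩
    A * pʲ * (G′ * (P * f j)) + A * G * P * f j
      ≈⟨ +-congʳ (*-congʳ exponents) ⟩
    B * Z * (G′ * (P * f j)) + A * G * P * f j
      ≈⟨ +-congʳ (solve 4 (λ b z g t → b :* z :* (g :* t) := b :* g :* t :* z) refl B Z G′ (P * f j)) ⟩
    B * G′ * (P * f j) * Z + A * G * P * f j
      ≈⟨ +-congʳ (*-congʳ (*-congˡ (∏<-last j f))) ⟨
    B * G′ * ∏< (suc j) f * Z + A * G * P * f j ∎
    where
    f : ℕ → Carrier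
    f i = [ x ℤ.+ + i ℤ.* (+ s ℤ.- + 1) ]
    p  = q^ (+ s ℤ.- + 1)
    pʲ = p ^ suc j
    A  = q^ (x ℤ.* (+ s′ ℤ.- + j))
    B  = q^ (x ℤ.* (+ s′ ℤ.- + suc j))
    Z  = q^ (x ℤ.+ + suc j ℤ.* (+ s ℤ.- + 1))
    G  = gauss p s′ j
    G′ = gauss p s′ (suc j)
    P  = ∏< j f
    shift : ∀ x a b → x ℤ.* (+ 1 ℤ.+ a ℤ.- (+ 1 ℤ.+ b)) ≡ x ℤ.* (a ℤ.- b)
    shift = ℤ-Solver.solve-∀
    regroup : ∀ x a b t → x ℤ.* (a ℤ.- b) ℤ.+ (+ 1 ℤ.+ b) ℤ.* t
                        ≡ x ℤ.* (a ℤ.- (+ 1 ℤ.+ b)) ℤ.+ (x ℤ.+ (+ 1 ℤ.+ b) ℤ.* t)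
    regroup = ℤ-Solver.solve-∀
    exponents : A * pʲ ≈ B * Z
    exponents = begin
      A * pʲ
        ≈⟨ *-congˡ (q^-* (+ s ℤ.- + 1) (suc j)) ⟨
      A * q^ (+ suc j ℤ.* (+ s ℤ.- + 1))
        ≈⟨ q^-+ (x ℤ.* (+ s′ ℤ.- + j)) (+ suc j ℤ.* (+ s ℤ.- + 1)) ⟨
      q^ (x ℤ.* (+ s′ ℤ.- + j) ℤ.+ + suc j ℤ.* (+ s ℤ.- + 1))
        ≈⟨ q^-cong (regroup x (+ s′) (+ j) (+ s ℤ.- + 1)) ⟩
      q^ (x ℤ.* (+ s′ ℤ.- + suc j) ℤ.+ (x ℤ.+ + suc j ℤ.* (+ s ℤ.- + 1)))
        ≈⟨ q^-+ (x ℤ.* (+ s′ ℤ.- + suc j)) (x ℤ.+ + suc j ℤ.* (+ s ℤ.- + 1)) ⟩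
      B * Z ∎

  Γ-negative : ∀ s e j s′ {n} → + e ℤ.+ + j ℤ.* (+ s ℤ.- + 1) ≡ -[1+ n ] → Γ s j (+ e) s′ ≈ 0#
  -- For positive `s` the difference `s - 1` is a natural number, so the exponent cannot be
  -- negative.
  Γ-negative (suc s) e j s′ eq with ≡.trans (≡.cong (λ x → + e ℤ.+ x) (ℤₚ.pos-* j s)) eq
  ... | ()
  Γ-negative zero e j s′ eq with e ℕₚ.<? j
  -- The factor with index `e` is the q-number of `e - e`; the index is admissible because `e < j`.
  ... | yes e<j = trans (*-congˡ (product-zero factor (fromℕ< e<j) vanish)) (zeroʳ _)
    where
    factor : Fin j → Carrier
    factor i = [ + e ℤ.+ + toℕ i ℤ.* -[1+ 0 ] ]
    cancel : ∀ x → x ℤ.+ x ℤ.* -[1+ 0 ] ≡ + 0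
    cancel = ℤ-Solver.solve-∀
    vanish : factor (fromℕ< e<j) ≈ 0#
    vanish = begin
      factor (fromℕ< e<j)            ≡⟨ ≡.cong (λ i → [ + e ℤ.+ + i ℤ.* -[1+ 0 ] ]) (toℕ-fromℕ< e<j) ⟩
      [ + e ℤ.+ + e ℤ.* -[1+ 0 ] ]   ≈⟨ [-]-cong (cancel (+ e)) ⟩
      [ + 0 ]                        ≈⟨ [0]≈0 ⟩
      0#                             ∎
  ... | no e≮j with ≡.trans (≡.sym nonneg) eq
    where
    minus : ∀ x y → x ℤ.+ y ℤ.* -[1+ 0 ] ≡ x ℤ.- y
    minus = ℤ-Solver.solve-∀
    nonneg : + e ℤ.+ + j ℤ.* -[1+ 0 ] ≡ + (e ∸ j)
    nonneg = ≡.trans (minus (+ e) (+ j)) (≡.trans (ℤₚ.m-n≡m⊖n e j) (ℤₚ.⊖-≥ (ℕₚ.≮⇒≥ e≮j)))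
  ...   | ()

  private
    -- Serves twice: with full sums for `R` and `J` it gives the total degree, and with prefix sums
    -- the middle argument of each remaining Γ.
    carry-degree : ∀ s e r j {d} R J → + e ℤ.+ + j ℤ.* (+ s ℤ.- + 1) ≡ + d →
      + (e ℕ.+ (r ℕ.+ R)) ℤ.+ + (j ℕ.+ J) ℤ.* (+ s ℤ.- + 1) ≡ + (r ℕ.+ d ℕ.+ R) ℤ.+ + J ℤ.* (+ s ℤ.- + 1)
    carry-degree s e r j R J eq =
      ≡.trans (identity (+ e) (+ r) (+ j) (+ R) (+ J) (+ s ℤ.- + 1))
              (≡.cong (λ x → + r ℤ.+ x ℤ.+ + R ℤ.+ + J ℤ.* (+ s ℤ.- + 1)) eq)
      where
      identity : ∀ e r j R J t →
        e ℤ.+ (r ℤ.+ R) ℤ.+ (j ℤ.+ J) ℤ.* t ≡ r ℤ.+ (e ℤ.+ j ℤ.* t) ℤ.+ R ℤ.+ J ℤ.* t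
      identity = ℤ-Solver.solve-∀

    first-degree : ∀ s e → + (e ℕ.+ 0) ℤ.+ + 0 ℤ.* (+ s ℤ.- + 1) ≡ + e
    first-degree s e = identity (+ e) (+ s ℤ.- + 1)
      where
      identity : ∀ e t → e ℤ.+ + 0 ℤ.+ + 0 ℤ.* t ≡ e
      identity = ℤ-Solver.solve-∀

  V-degree-∷ : ∀ {m} s e r j {d} (𝐫 𝐣 : Vec ℕ m) → + e ℤ.+ + j ℤ.* (+ s ℤ.- + 1) ≡ + d →
    V-degree s (e ∷ r ∷ 𝐫) (j ∷ 𝐣) ≡ V-degree s (r ℕ.+ d ∷ 𝐫) 𝐣
  V-degree-∷ s e r j 𝐫 𝐣 = carry-degree s e r j (sum 𝐫) (sum 𝐣)

  -- Γ[j₁ , e , t] moves V^e to the left of U^t, after which V^(r + d) is the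
  -- rightmost power of V.
  ΓProduct-∷ : ∀ {m} s e r k k′ t j {d} (𝐫 𝐬 𝐣 : Vec ℕ m) → + e ℤ.+ + j ℤ.* (+ s ℤ.- + 1) ≡ + d →
    ΓProduct s (e ∷ r ∷ 𝐫) (k ∷ t ∷ 𝐬) (j ∷ 𝐣)
      ≈ Γ s j (+ e) t * ΓProduct s (r ℕ.+ d ∷ 𝐫) (k′ ∷ 𝐬) 𝐣
  ΓProduct-∷ s e r k k′ t j 𝐫 𝐬 𝐣 eq = *-cong
    (Γ-cong s j t (first-degree s e))
    (product-cong λ i → Γ-cong s (lookup 𝐣 i) (lookup 𝐬 i)
      (carry-degree s e r j (prefixSum 𝐫 (toℕ i)) (prefixSum 𝐣 (toℕ i)) eq))

  ΓProduct-∷-negative : ∀ {m} s e r k t j {n} (𝐫 𝐬 𝐣 : Vec ℕ m) →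
    + e ℤ.+ + j ℤ.* (+ s ℤ.- + 1) ≡ -[1+ n ] → ΓProduct s (e ∷ r ∷ 𝐫) (k ∷ t ∷ 𝐬) (j ∷ 𝐣) ≈ 0#
  ΓProduct-∷-negative s e r k t j 𝐫 𝐬 𝐣 eq =
    trans (*-congʳ (trans (Γ-cong s j t (first-degree s e)) (Γ-negative s e j t eq))) (zeroˡ _)

  -- Merging preserves the total degree, and for a single block the degree is a natural number. A
  -- negative total therefore forces a negative exponent at some merge, where `Γ-negative` applies.
  ΓProduct-negative : ∀ {m} s (𝐫 𝐬 : Vec ℕ (suc m)) 𝐣 → V-degree s 𝐫 𝐣 ℤ.< + 0 → ΓProduct s 𝐫 𝐬 𝐣 ≈ 0#
  ΓProduct-negative s (e ∷ []) (k ∷ []) [] neg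
    with ≡.subst (ℤ._< + 0) (first-degree s e) neg
  ... | ℤ.+<+ ()
  ΓProduct-negative s (e ∷ r ∷ 𝐫) (k ∷ t ∷ 𝐬) (j ∷ 𝐣) neg
    with + e ℤ.+ + j ℤ.* (+ s ℤ.- + 1) in eq
  ... | -[1+ n ] = ΓProduct-∷-negative s e r k t j 𝐫 𝐬 𝐣 eq
  ... | + d = begin
    ΓProduct s (e ∷ r ∷ 𝐫) (k ∷ t ∷ 𝐬) (j ∷ 𝐣)
      ≈⟨ ΓProduct-∷ s e r k k t j 𝐫 𝐬 𝐣 eq ⟩
    Γ s j (+ e) t * ΓProduct s (r ℕ.+ d ∷ 𝐫) (k ∷ 𝐬) 𝐣
      ≈⟨ *-congˡ (ΓProduct-negative s (r ℕ.+ d ∷ 𝐫) (k ∷ 𝐬) 𝐣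
           (≡.subst (ℤ._< + 0) (V-degree-∷ s e r j 𝐫 𝐣 eq) neg)) ⟩
    Γ s j (+ e) t * 0#
      ≈⟨ zeroʳ _ ⟩
    0# ∎

  ΓProduct-above : ∀ {m} s (𝐫 𝐬 : Vec ℕ (suc m)) 𝐣 i → lookup (tail 𝐬) i < lookup 𝐣 i →
    ΓProduct s 𝐫 𝐬 𝐣 ≈ 0#
  ΓProduct-above s 𝐫 (k ∷ 𝐬) 𝐣 i lt =
    product-zero (λ i → Γ s (lookup 𝐣 i) (degree i) (lookup 𝐬 i)) i (Γ-above s (degree i) lt)
    where
    degree : Fin _ → ℤ
    degree i = + prefixSum 𝐫 (suc (toℕ i)) ℤ.+ + prefixSum 𝐣 (toℕ i) ℤ.* (+ s ℤ.- + 1)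

  -- `k′` is left free so that it can become the exponent `t ∸ j + k` of U in the merged block.
  coefficient-∷ : ∀ {m} s h e r k k′ t j {d} (𝐫 𝐬 𝐣 : Vec ℕ m) → + e ℤ.+ + j ℤ.* (+ s ℤ.- + 1) ≡ + d →
    coefficient s h (e ∷ r ∷ 𝐫) (k ∷ t ∷ 𝐬) (j ∷ 𝐣)
      ≈ (h ^ j * Γ s j (+ e) t) * coefficient s h (r ℕ.+ d ∷ 𝐫) (k′ ∷ 𝐬) 𝐣
  coefficient-∷ s h e r k k′ t j 𝐫 𝐬 𝐣 eq = begin
    h ^ (j ℕ.+ sum 𝐣) * ΓProduct s (e ∷ r ∷ 𝐫) (k ∷ t ∷ 𝐬) (j ∷ 𝐣)
      ≈⟨ *-cong (^-homo-* h j (sum 𝐣)) (ΓProduct-∷ s e r k k′ t j 𝐫 𝐬 𝐣 eq) ⟩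
    h ^ j * h ^ sum 𝐣 * (g * p)
      ≈⟨ solve 4 (λ a b g p → a :* b :* (g :* p) := a :* g :* (b :* p)) refl (h ^ j) (h ^ sum 𝐣) g p ⟩
    h ^ j * g * (h ^ sum 𝐣 * p) ∎
    where
    g = Γ s j (+ e) t
    p = ΓProduct s (_ ∷ 𝐫) (k′ ∷ 𝐬) 𝐣

-- Scalar multiplication in an associative algebra.

module AlgebraProperties {c ℓ₁ a ℓ} {R : CommutativeRing c ℓ₁} (A : AssociativeAlgebra R a ℓ) where
  private module R = CommutativeRing R
  open AssociativeAlgebra A public
  open IsRingHomomorphism isRingHomomorphism public
    using () renaming (⟦⟧-cong to ι-cong; +-homo to ι-+; *-homo to ι-*; 0#-homo to ι-0; 1#-homo to ι-1)
  open SetoidReasoning setoid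

  infixr 7 _•_
  _•_ : R.Carrier → Carrier → Carrier
  k • x = ι k * x

  •-cong : ∀ {k l x y} → k R.≈ l → x ≈ y → k • x ≈ l • y
  •-cong k≈l x≈y = *-cong (ι-cong k≈l) x≈y

  •-zeroˡ : ∀ {k} x → k R.≈ R.0# → k • x ≈ 0#
  •-zeroˡ x k≈0 = trans (*-congʳ (trans (ι-cong k≈0) ι-0)) (zeroˡ x)

  •-identity : ∀ x → R.1# • x ≈ x
  •-identity x = trans (*-congʳ ι-1) (*-identityˡ x)

  •-+ : ∀ k l x → (k R.+ l) • x ≈ k • x + l • x
  •-+ k l x = trans (*-congʳ (ι-+ k l)) (distribʳ x _ _)

  •-• : ∀ k l x → k • l • x ≈ (k R.* l) • x
  •-• k l x = trans (sym (*-assoc _ _ x)) (*-congʳ (sym (ι-* k l)))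

  •-*ˡ : ∀ k x y → (k • x) * y ≈ k • (x * y)
  •-*ˡ k x y = *-assoc _ x y

  •-*ʳ : ∀ k x y → x * (k • y) ≈ k • (x * y)
  •-*ʳ k x y = begin
    x * (ι k * y) ≈⟨ *-assoc x (ι k) y ⟨
    x * ι k * y   ≈⟨ *-congʳ (ι-central k x) ⟨
    ι k * x * y   ≈⟨ *-assoc (ι k) x y ⟩
    ι k * (x * y) ∎

-- The normal ordering expansion in an arbitrary algebra.

module NormalOrder {c ℓ₁ ℓ₂ a ℓ} (K : HeytingField c ℓ₁ ℓ₂)
  (q : HeytingField.Carrier K)
  (q#0 : HeytingField._#_ K q (HeytingField.0# K))
  (q≟1 : HeytingField._≈_ K q (HeytingField.1# K) ⊎ HeytingField._#_ K q (HeytingField.1# K))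
  (s : ℕ) (h : HeytingField.Carrier K)
  (A : AssociativeAlgebra (QNumbers.commutativeRing K q q#0 q≟1) a ℓ)
  (U V : AssociativeAlgebra.Carrier A)
  where

  open QNumberProperties K q q#0 q≟1
    using (commutativeRing; Γ; [_]; q^; [0]≈0; [suc]; Γ-suc-zero; Γ-suc-suc; Γ-above; Γ-negative;
           coefficient; coefficient-∷; V-degree; V-degree-∷; ΓProduct-∷-negative)
  private
    module R = CommutativeRing commutativeRing
    open Exp R.semiring using () renaming (_^_ to _^ᴿ_)
  open AlgebraProperties A
  open Words A U V
  open Exp semiring using (^-homo-*)
  open FiniteSums +-commutativeMonoid
  open Solver R.commutativeSemiring using (solve; _:+_; _:*_; _:=_; con)
  open SetoidReasoning setoid

  monomial-cong : ∀ {x y} k → x ≡ y → monomial x k ≈ monomial y k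
  monomial-cong k ≡.refl = refl

  scaling-nestedSum : ∀ {m} k (bs : Vec ℕ m) f → k • nestedSum bs f ≈ nestedSum bs (λ 𝐣 → k • f 𝐣)
  scaling-nestedSum k =
    AdditiveMaps.nestedSum-map +-commutativeMonoid +-commutativeMonoid (k •_) (zeroʳ _) (distribˡ (ι k))

  *-∑<ˡ : ∀ x n f → x * ∑< n f ≈ ∑< n (λ i → x * f i)
  *-∑<ˡ x = AdditiveMaps.∑<-map +-commutativeMonoid +-commutativeMonoid (x *_) (zeroʳ x) (distribˡ x)

  *-∑<ʳ : ∀ x n f → ∑< n f * x ≈ ∑< n (λ i → f i * x)
  *-∑<ʳ x = AdditiveMaps.∑<-map +-commutativeMonoid +-commutativeMonoid (_* x) (zeroˡ x) (distribʳ x)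

  -- The exponent left of `V ^ e` after `j` contractions, each of which removes one V and inserts
  -- `V ^ s`.
  z : ℕ → ℕ → ℤ
  z e j = + e ℤ.+ + j ℤ.* (+ s ℤ.- + 1)

  z-suc : ∀ e j → z e j ℤ.+ (+ s ℤ.- + 1) ≡ z e (suc j)
  z-suc e j = identity (+ e) (+ j) (+ s ℤ.- + 1)
    where
    identity : ∀ e j t → e ℤ.+ j ℤ.* t ℤ.+ t ≡ e ℤ.+ (+ 1 ℤ.+ j) ℤ.* t
    identity = ℤ-Solver.solve-∀

  module _ (relation : U * V - ι q * (V * U) ≈ ι h * V ^ s) where

    UV : U * V ≈ q • (V * U) + h • V ^ s
    UV = begin
      U * V                                        ≈⟨ +-identityʳ _ ⟨
      U * V + 0#                                   ≈⟨ +-congˡ (-‿inverseˡ _) ⟨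
      U * V + (- (q • (V * U)) + q • (V * U))      ≈⟨ +-assoc _ _ _ ⟨
      U * V - q • (V * U) + q • (V * U)            ≈⟨ +-congʳ relation ⟩
      h • V ^ s + q • (V * U)                      ≈⟨ +-comm _ _ ⟩
      q • (V * U) + h • V ^ s                      ∎

    -- For e = 0 the truncated e ∸ 1 is harmless, since [0] = 0.
    U-V^ : ∀ e → U * V ^ e ≈ (q ^ᴿ e) • (V ^ e * U) + (h R.* [ + e ]) • V ^ (e ∸ 1 ℕ.+ s)
    U-V^ zero = begin
      U * 1#                 ≈⟨ trans (*-identityʳ U) (sym (*-identityˡ U)) ⟩
      1# * U                 ≈⟨ •-identity _ ⟨
      R.1# • (1# * U)        ≈⟨ +-identityʳ _ ⟨
      R.1# • (1# * U) + 0#   ≈⟨ +-congˡ (•-zeroˡ _ (R.trans (R.*-congˡ [0]≈0) (R.zeroʳ h))) ⟨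
      R.1# • (1# * U) + (h R.* [ + 0 ]) • V ^ s ∎
    U-V^ (suc e) = begin
      U * (V * V ^ e)
        ≈⟨ *-assoc U V _ ⟨
      U * V * V ^ e
        ≈⟨ *-congʳ UV ⟩
      (q • (V * U) + h • V ^ s) * V ^ e
        ≈⟨ distribʳ _ _ _ ⟩
      (q • (V * U)) * V ^ e + (h • V ^ s) * V ^ e
        ≈⟨ +-cong (trans (•-*ˡ q _ _) (*-congˡ (*-assoc V U _)))
                  (trans (•-*ˡ h _ _) (*-congˡ (sym (^-homo-* V s e)))) ⟩
      q • (V * (U * V ^ e)) + h • V ^ (s ℕ.+ e)
        ≈⟨ +-congʳ (*-congˡ (*-congˡ (U-V^ e))) ⟩
      q • (V * ((q ^ᴿ e) • (V ^ e * U) + b • V ^ (e ∸ 1 ℕ.+ s))) + h • V ^ (s ℕ.+ e)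
        ≈⟨ +-congʳ (trans (*-congˡ (trans (distribˡ V _ _) (+-cong (•-*ʳ _ V _) (•-*ʳ b V _)))) (distribˡ _ _ _)) ⟩
      q • (q ^ᴿ e) • (V * (V ^ e * U)) + q • b • (V * V ^ (e ∸ 1 ℕ.+ s)) + h • V ^ (s ℕ.+ e)
        ≈⟨ +-congʳ (+-cong (trans (•-• q _ _) (*-congˡ (sym (*-assoc V _ U)))) (*-congˡ (raise e))) ⟩
      (q ^ᴿ suc e) • (V ^ suc e * U) + q • b • V ^ (e ℕ.+ s) + h • V ^ (s ℕ.+ e)
        ≈⟨ +-assoc _ _ _ ⟩
      (q ^ᴿ suc e) • (V ^ suc e * U) + (q • b • V ^ (e ℕ.+ s) + h • V ^ (s ℕ.+ e))
        ≈⟨ +-congˡ (+-cong (•-• q b _) (*-congˡ (reflexive (≡.cong (V ^_) (ℕₚ.+-comm s e))))) ⟩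
      (q ^ᴿ suc e) • (V ^ suc e * U) + ((q R.* b) • V ^ (e ℕ.+ s) + h • V ^ (e ℕ.+ s))
        ≈⟨ +-congˡ (•-+ _ h _) ⟨
      (q ^ᴿ suc e) • (V ^ suc e * U) + (q R.* b R.+ h) • V ^ (e ℕ.+ s)
        ≈⟨ +-congˡ (•-cong next refl) ⟩
      (q ^ᴿ suc e) • (V ^ suc e * U) + (h R.* [ + suc e ]) • V ^ (e ℕ.+ s) ∎
      where
      b = h R.* [ + e ]
      raise : ∀ e → (h R.* [ + e ]) • (V * V ^ (e ∸ 1 ℕ.+ s)) ≈ (h R.* [ + e ]) • V ^ (e ℕ.+ s)
      raise zero    = trans (•-zeroˡ _ h[0]≈0) (sym (•-zeroˡ _ h[0]≈0))
        where h[0]≈0 = R.trans (R.*-congˡ [0]≈0) (R.zeroʳ h)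
      raise (suc e) = refl
      next : q R.* b R.+ h R.≈ h R.* [ + suc e ]
      next = R.trans (solve 3 (λ q h x → q :* (h :* x) :+ h := h :* (q :* x :+ con 1)) R.refl q h [ + e ])
                     (R.*-congˡ (R.sym ([suc] e)))

    -- Passes from the truncated exponent to the integer one. At `e = 0` these are `s` and `s - 1`,
    -- and the two monomials differ, but both are multiplied by `h [ 0 ] = 0`.
    U-monomial : ∀ e k → U * monomial (+ e) k
      ≈ (q ^ᴿ e) • monomial (+ e) (suc k) + (h R.* [ + e ]) • monomial (+ e ℤ.+ (+ s ℤ.- + 1)) k
    U-monomial e k = begin
      U * (V ^ e * U ^ k)
        ≈⟨ *-assoc U _ _ ⟨
      U * V ^ e * U ^ k
        ≈⟨ *-congʳ (U-V^ e) ⟩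
      ((q ^ᴿ e) • (V ^ e * U) + b • V ^ (e ∸ 1 ℕ.+ s)) * U ^ k
        ≈⟨ distribʳ _ _ _ ⟩
      ((q ^ᴿ e) • (V ^ e * U)) * U ^ k + (b • V ^ (e ∸ 1 ℕ.+ s)) * U ^ k
        ≈⟨ +-cong (trans (•-*ˡ _ _ _) (*-congˡ (*-assoc _ U _))) (•-*ˡ b _ _) ⟩
      (q ^ᴿ e) • (V ^ e * (U * U ^ k)) + b • (V ^ (e ∸ 1 ℕ.+ s) * U ^ k)
        ≈⟨ +-congˡ (lower e) ⟩
      (q ^ᴿ e) • (V ^ e * (U * U ^ k)) + b • monomial (+ e ℤ.+ (+ s ℤ.- + 1)) k ∎
      where
      b = h R.* [ + e ]
      lower : ∀ e → (h R.* [ + e ]) • (V ^ (e ∸ 1 ℕ.+ s) * U ^ k)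
                  ≈ (h R.* [ + e ]) • monomial (+ e ℤ.+ (+ s ℤ.- + 1)) k
      lower zero    = trans (•-zeroˡ _ h[0]≈0) (sym (•-zeroˡ _ h[0]≈0))
        where h[0]≈0 = R.trans (R.*-congˡ [0]≈0) (R.zeroʳ h)
      lower (suc e) = *-congˡ (monomial-cong k (identity (+ e) (+ s)))
        where
        identity : ∀ e s → e ℤ.+ s ≡ + 1 ℤ.+ e ℤ.+ (s ℤ.- + 1)
        identity = ℤ-Solver.solve-∀

    private
      κ : ℕ → ℕ → ℕ → R.Carrier
      κ e t j = (h ^ᴿ j) R.* Γ s j (+ e) t

      κ-zero : ∀ e t → κ e t 0 R.* q^ (z e 0) R.≈ κ e (suc t) 0
      κ-zero e t = R.trans (R.*-assoc _ _ _) (R.*-congˡ (R.sym (Γ-suc-zero s (+ e) t)))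

      κ-suc : ∀ e t j →
        κ e t (suc j) R.* q^ (z e (suc j)) R.+ κ e t j R.* (h R.* [ z e j ]) R.≈ κ e (suc t) (suc j)
      κ-suc e t j = R.trans
        (solve 6 (λ h p x y g b → h :* p :* x :* y :+ p :* g :* (h :* b) := h :* p :* (x :* y :+ g :* b))
           R.refl h (h ^ᴿ j) (Γ s (suc j) (+ e) t) (q^ (z e (suc j))) (Γ s j (+ e) t) [ z e j ])
        (R.*-congˡ (R.sym (Γ-suc-suc s j (+ e) t)))

      U-term : ∀ e t j k → U * (κ e t j • monomial (z e j) k)
        ≈ (κ e t j R.* q^ (z e j)) • monomial (z e j) (suc k)
          + (κ e t j R.* (h R.* [ z e j ])) • monomial (z e (suc j)) k
      -- `z-suc` is abstracted along with `z e j`, so that it turns into an equation for the natural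
      -- exponent `d`. If the exponent is negative, `κ e t j` is zero and annihilates both terms on
      -- the right.
      U-term e t j k with z e j in eq | z-suc e j
      ... | -[1+ n ] | _ = begin
        U * (κ e t j • 0#)      ≈⟨ trans (*-congˡ (zeroʳ _)) (zeroʳ U) ⟩
        0#                       ≈⟨ +-identityˡ 0# ⟨
        0# + 0#                  ≈⟨ +-cong (•-zeroˡ _ (annihilate _)) (•-zeroˡ _ (annihilate _)) ⟨
        _ • _ + _ • _            ∎
        where
        annihilate : ∀ x → κ e t j R.* x R.≈ R.0#
        annihilate x = R.trans (R.*-congʳ (R.trans (R.*-congˡ (Γ-negative s e j t eq)) (R.zeroʳ _))) (R.zeroˡ x)
      ... | + d | eq′ = begin
        U * (κ e t j • monomial (+ d) k)
          ≈⟨ •-*ʳ _ U _ ⟩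
        κ e t j • (U * monomial (+ d) k)
          ≈⟨ *-congˡ (U-monomial d k) ⟩
        κ e t j • ((q ^ᴿ d) • monomial (+ d) (suc k) + (h R.* [ + d ]) • monomial (+ d ℤ.+ (+ s ℤ.- + 1)) k)
          ≈⟨ distribˡ _ _ _ ⟩
        κ e t j • (q ^ᴿ d) • monomial (+ d) (suc k)
          + κ e t j • (h R.* [ + d ]) • monomial (+ d ℤ.+ (+ s ℤ.- + 1)) k
          ≈⟨ +-cong (•-• _ _ _) (trans (•-• _ _ _) (*-congˡ (monomial-cong k eq′))) ⟩
        (κ e t j R.* (q ^ᴿ d)) • monomial (+ d) (suc k)
          + (κ e t j R.* (h R.* [ + d ])) • monomial (z e (suc j)) k ∎

    U^-V^ : ∀ t e → U ^ t * V ^ e ≈ ∑< (suc t) (λ j → κ e t j • monomial (z e j) (t ∸ j))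
    U^-V^ zero e = begin
      1# * V ^ e                         ≈⟨ trans (*-identityˡ _) (sym (*-identityʳ _)) ⟩
      monomial (+ e) 0                   ≈⟨ monomial-cong 0 (z-zero (+ e) (+ s)) ⟨
      monomial (z e 0) 0                 ≈⟨ •-identity _ ⟨
      R.1# • monomial (z e 0) 0          ≈⟨ •-cong κ≈1 refl ⟨
      κ e 0 0 • monomial (z e 0) 0      ≈⟨ +-identityʳ _ ⟨
      κ e 0 0 • monomial (z e 0) 0 + 0# ∎
      where
      z-zero : ∀ e s → e ℤ.+ + 0 ℤ.* (s ℤ.- + 1) ≡ e
      z-zero = ℤ-Solver.solve-∀
      κ≈1 : κ e 0 0 R.≈ R.1#
      κ≈1 = R.trans (R.*-identityˡ _) (R.trans (R.*-identityʳ _) (R.trans (R.*-identityʳ _)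
               (R.reflexive (≡.cong q^ (ℤₚ.*-zeroʳ (+ e))))))
    U^-V^ (suc t) e = begin
      U * U ^ t * V ^ e
        ≈⟨ *-assoc U _ _ ⟩
      U * (U ^ t * V ^ e)
        ≈⟨ *-congˡ (U^-V^ t e) ⟩
      U * ∑< (suc t) (λ j → κ e t j • monomial (z e j) (t ∸ j))
        ≈⟨ *-∑<ˡ U (suc t) (λ j → κ e t j • monomial (z e j) (t ∸ j)) ⟩
      ∑< (suc t) (λ j → U * (κ e t j • monomial (z e j) (t ∸ j)))
        ≈⟨ ∑<-cong (suc t) (λ j j<1+t → trans (U-term e t j (t ∸ j))
             (+-congʳ (*-congˡ (reflexive (≡.cong (monomial (z e j)) (≡.sym (ℕₚ.+-∸-assoc 1 (ℕₚ.≤-pred j<1+t)))))))) ⟩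
      ∑< (suc t) (λ j → x j + y j)
        ≈⟨ ∑<-distrib (suc t) x y ⟩
      ∑< (suc t) x + ∑< (suc t) y
        -- The sum of the passing terms is extended to index `t + 1`, where Γ vanishes. With `x 0`
        -- split off, `x (suc j)` then stands beside `y j`: both belong to `j + 1` contractions, and
        -- `κ-suc` adds their coefficients.
        ≈⟨ +-congʳ (trans (sym (+-identityʳ _)) (+-congˡ (sym x-last))) ⟩
      ∑< (suc t) x + x (suc t) + ∑< (suc t) y
        ≈⟨ +-congʳ (∑<-last (suc t) x) ⟨
      x 0 + ∑< (suc t) (λ j → x (suc j)) + ∑< (suc t) y
        ≈⟨ +-assoc _ _ _ ⟩
      x 0 + (∑< (suc t) (λ j → x (suc j)) + ∑< (suc t) y)
        ≈⟨ +-congˡ (∑<-distrib (suc t) (λ j → x (suc j)) y) ⟨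
      x 0 + ∑< (suc t) (λ j → x (suc j) + y j)
        ≈⟨ +-cong (•-cong (κ-zero e t) refl)
             (∑<-cong (suc t) λ j _ → trans (sym (•-+ _ _ (monomial (z e (suc j)) (t ∸ j)))) (•-cong (κ-suc e t j) refl)) ⟩
      ∑< (suc (suc t)) (λ j → κ e (suc t) j • monomial (z e j) (suc t ∸ j)) ∎
      where
      x y : ℕ → Carrier
      x j = (κ e t j R.* q^ (z e j)) • monomial (z e j) (suc t ∸ j)
      y j = (κ e t j R.* (h R.* [ z e j ])) • monomial (z e (suc j)) (t ∸ j)
      x-last : x (suc t) ≈ 0#
      x-last = •-zeroˡ _ (R.trans (R.*-congʳ (R.trans (R.*-congˡ (Γ-above s (+ e) (ℕₚ.n<1+n t))) (R.zeroʳ _)))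
                                  (R.zeroˡ _))

    H-expansion : ∀ {m} (𝐫 𝐬 : Vec ℕ (suc m)) →
      H 𝐫 𝐬 ≈ nestedSum (tail 𝐬) (λ 𝐣 →
        coefficient s h 𝐫 𝐬 𝐣 • monomial (V-degree s 𝐫 𝐣) (sum 𝐬 ∸ sum 𝐣))
    H-expansion {zero} (e ∷ []) (k ∷ []) = begin
      1# * (V ^ e * U ^ k)
        ≈⟨ *-identityˡ _ ⟩
      monomial (+ e) k
        ≈⟨ reflexive (≡.cong₂ monomial (degree (+ e) (+ s)) (ℕₚ.+-identityʳ k)) ⟨
      monomial (V-degree s (e ∷ []) []) (k ℕ.+ 0)
        ≈⟨ •-identity _ ⟨
      R.1# • monomial (V-degree s (e ∷ []) []) (k ℕ.+ 0)
        ≈⟨ •-cong (R.*-identityˡ R.1#) refl ⟨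
      (R.1# R.* R.1#) • monomial (V-degree s (e ∷ []) []) (k ℕ.+ 0) ∎
      where
      degree : ∀ e s → e ℤ.+ + 0 ℤ.+ + 0 ℤ.* (s ℤ.- + 1) ≡ e
      degree = ℤ-Solver.solve-∀
    H-expansion {suc m} (e ∷ r ∷ 𝐫) (k ∷ t ∷ 𝐬) = begin
      H 𝐫 𝐬 * (V ^ r * U ^ t) * (V ^ e * U ^ k)
        ≈⟨ *-assoc _ _ _ ⟩
      H 𝐫 𝐬 * (V ^ r * U ^ t * (V ^ e * U ^ k))
        ≈⟨ *-congˡ (trans (*-assoc _ _ _) (*-congˡ (sym (*-assoc _ _ _)))) ⟩
      H 𝐫 𝐬 * (V ^ r * (U ^ t * V ^ e * U ^ k))
        ≈⟨ *-congˡ (*-congˡ (trans (*-congʳ (U^-V^ t e))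
             (*-∑<ʳ (U ^ k) (suc t) (λ j → κ e t j • monomial (z e j) (t ∸ j))))) ⟩
      H 𝐫 𝐬 * (V ^ r * ∑< (suc t) (λ j → (κ e t j • monomial (z e j) (t ∸ j)) * U ^ k))
        ≈⟨ *-congˡ (*-∑<ˡ (V ^ r) (suc t) (λ j → (κ e t j • monomial (z e j) (t ∸ j)) * U ^ k)) ⟩
      H 𝐫 𝐬 * ∑< (suc t) (λ j → V ^ r * ((κ e t j • monomial (z e j) (t ∸ j)) * U ^ k))
        ≈⟨ *-∑<ˡ (H 𝐫 𝐬) (suc t) (λ j → V ^ r * ((κ e t j • monomial (z e j) (t ∸ j)) * U ^ k)) ⟩
      ∑< (suc t) (λ j → H 𝐫 𝐬 * (V ^ r * ((κ e t j • monomial (z e j) (t ∸ j)) * U ^ k)))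
        ≈⟨ ∑<-cong (suc t) (λ j j<1+t → summand j (ℕₚ.≤-pred j<1+t)) ⟩
      ∑< (suc t) (λ j → nestedSum 𝐬 (λ 𝐣 → rhs (j ∷ 𝐣))) ∎
      where
      rhs : Vec ℕ (suc m) → Carrier
      rhs 𝐣 = coefficient s h (e ∷ r ∷ 𝐫) (k ∷ t ∷ 𝐬) 𝐣
        • monomial (V-degree s (e ∷ r ∷ 𝐫) 𝐣) (sum (k ∷ t ∷ 𝐬) ∸ sum 𝐣)

      summand : ∀ j → j ≤ t →
        H 𝐫 𝐬 * (V ^ r * ((κ e t j • monomial (z e j) (t ∸ j)) * U ^ k)) ≈ nestedSum 𝐬 (λ 𝐣 → rhs (j ∷ 𝐣))
      summand j j≤t with z e j in eq
      -- No merged word exists here. The left side is zero by the reading of monomials, and on the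
      -- right all coefficients whose first index is `j` vanish.
      ... | -[1+ n ] = begin
        H 𝐫 𝐬 * (V ^ r * ((κ e t j • 0#) * U ^ k))
          ≈⟨ *-congˡ (*-congˡ (trans (*-congʳ (zeroʳ _)) (zeroˡ _))) ⟩
        H 𝐫 𝐬 * (V ^ r * 0#)
          ≈⟨ trans (*-congˡ (zeroʳ _)) (zeroʳ _) ⟩
        0#
          ≈⟨ nestedSum-zero 𝐬 (λ 𝐣 → •-zeroˡ _
               (R.trans (R.*-congˡ (ΓProduct-∷-negative s e r k t j 𝐫 𝐬 𝐣 eq)) (R.zeroʳ _))) ⟨
        nestedSum 𝐬 (λ 𝐣 → rhs (j ∷ 𝐣)) ∎
      ... | + d = begin
        H 𝐫 𝐬 * (V ^ r * ((γ • (V ^ d * U ^ (t ∸ j))) * U ^ k))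
          ≈⟨ *-congˡ (trans (*-congˡ (•-*ˡ γ _ _)) (•-*ʳ γ _ _)) ⟩
        H 𝐫 𝐬 * (γ • (V ^ r * (V ^ d * U ^ (t ∸ j) * U ^ k)))
          ≈⟨ •-*ʳ γ _ _ ⟩
        γ • (H 𝐫 𝐬 * (V ^ r * (V ^ d * U ^ (t ∸ j) * U ^ k)))
          ≈⟨ *-congˡ (*-congˡ (begin
               V ^ r * (V ^ d * U ^ (t ∸ j) * U ^ k)   ≈⟨ *-congˡ (*-assoc _ _ _) ⟩
               V ^ r * (V ^ d * (U ^ (t ∸ j) * U ^ k)) ≈⟨ *-assoc _ _ _ ⟨
               V ^ r * V ^ d * (U ^ (t ∸ j) * U ^ k)   ≈⟨ *-cong (^-homo-* V r d) (^-homo-* U (t ∸ j) k) ⟨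
               V ^ (r ℕ.+ d) * U ^ (t ∸ j ℕ.+ k)       ∎)) ⟩
        γ • H (r ℕ.+ d ∷ 𝐫) (k′ ∷ 𝐬)
          ≈⟨ *-congˡ (H-expansion (r ℕ.+ d ∷ 𝐫) (k′ ∷ 𝐬)) ⟩
        γ • nestedSum 𝐬 rest
          ≈⟨ scaling-nestedSum γ 𝐬 rest ⟩
        nestedSum 𝐬 (λ 𝐣 → γ • rest 𝐣)
          ≈⟨ nestedSum-cong 𝐬 (λ 𝐣 → trans (•-• γ _ _) (•-cong
               (R.sym (coefficient-∷ s h e r k k′ t j 𝐫 𝐬 𝐣 eq))
               (reflexive (≡.cong₂ monomial (≡.sym (V-degree-∷ s e r j 𝐫 𝐣 eq))
                 (remaining-degree k (sum 𝐬) (sum 𝐣) j≤t))))) ⟩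
        nestedSum 𝐬 (λ 𝐣 → rhs (j ∷ 𝐣)) ∎
        where
        γ = κ e t j
        k′ = t ∸ j ℕ.+ k
        rest : Vec ℕ m → Carrier
        rest 𝐣 = coefficient s h (r ℕ.+ d ∷ 𝐫) (k′ ∷ 𝐬) 𝐣
          • monomial (V-degree s (r ℕ.+ d ∷ 𝐫) 𝐣) (sum (k′ ∷ 𝐬) ∸ sum 𝐣)

-- Left multiplication by a term on the free module with basis V^i U^j has a
-- transpose, acting on arbitrary functions of (i , j). This right action
-- respects the defining relation, so it separates the monomials V^i U^j.
module DualAction {c ℓ₁ ℓ₂} (K : HeytingField c ℓ₁ ℓ₂)
  (q : HeytingField.Carrier K)
  (q#0 : HeytingField._#_ K q (HeytingField.0# K))
  (q≟1 : HeytingField._≈_ K q (HeytingField.1# K) ⊎ HeytingField._#_ K q (HeytingField.1# K))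
  (s : ℕ) (h : HeytingField.Carrier K)
  where

  open QNumberProperties K q q#0 q≟1 using (commutativeRing; [_]; [0]≈0; [suc])
  open CommutativeRing commutativeRing
    renaming (distribˡ to *-distribˡ-+; distribʳ to *-distribʳ-+)
  open Exp semiring using (_^_)
  open RingProperties ring using (-‿+-comm; -‿distribˡ-*; -‿distribʳ-*)
  open Solver commutativeSemiring using (solve; _:+_; _:*_; _:=_; con)
  open SetoidReasoning setoid
  open Presented commutativeRing s h q
  private
    module A = AlgebraProperties algebra
  open Words algebra 𝐔 𝐕 using (monomial)

  -- Let F be the linear functional with F(V^i U^j) = `f i j`. Then `act t f i j` is F(t V^i U^j),
  -- which explains the reversed order in the clause for `⊠`. The clause for `𝐔` is the rule for U
  -- V^i; its truncated `i ∸ 1` at `i = 0` is multiplied by `[ 0 ]`. Arbitrary functions spare the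
  -- finite supports of the free module.
  act : Term → (ℕ → ℕ → Carrier) → ℕ → ℕ → Carrier
  act 𝐔         f i j = q ^ i * f i (suc j) + h * [ + i ] * f (i ∸ 1 ℕ.+ s) j
  act 𝐕         f i j = f (suc i) j
  act (const k) f i j = k * f i j
  act (t ⊞ u)   f i j = act t f i j + act u f i j
  act (t ⊠ u)   f     = act u (act t f)
  act (⊟ t)     f i j = - act t f i j

  act-cong : ∀ t {f g : ℕ → ℕ → Carrier} → (∀ i j → f i j ≈ g i j) → ∀ i j → act t f i j ≈ act t g i j
  act-cong 𝐔         eq i j = +-cong (*-congˡ (eq i (suc j))) (*-congˡ (eq _ j))
  act-cong 𝐕         eq i j = eq (suc i) j
  act-cong (const k) eq i j = *-congˡ (eq i j)
  act-cong (t ⊞ u)   eq i j = +-cong (act-cong t eq i j) (act-cong u eq i j)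
  act-cong (t ⊠ u)   eq     = act-cong u (act-cong t eq)
  act-cong (⊟ t)     eq i j = -‿cong (act-cong t eq i j)

  -- With `act-*` this says that terms act linearly. Right distributivity rests on additivity and
  -- centrality of scalars on homogeneity, whereas left distributivity and associativity hold by
  -- computation.
  act-+ : ∀ t f g i j → act t (λ i j → f i j + g i j) i j ≈ act t f i j + act t g i j
  act-+ 𝐔 f g i j = solve 6 (λ p b x y z w → p :* (x :+ y) :+ b :* (z :+ w)
      := p :* x :+ b :* z :+ (p :* y :+ b :* w)) refl (q ^ i) (h * [ + i ]) _ _ _ _
  act-+ 𝐕         f g i j = refl
  act-+ (const k) f g i j = *-distribˡ-+ k _ _
  act-+ (t ⊞ u)   f g i j = trans (+-cong (act-+ t f g i j) (act-+ u f g i j))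
    (solve 4 (λ x y z w → x :+ y :+ (z :+ w) := x :+ z :+ (y :+ w)) refl _ _ _ _)
  act-+ (t ⊠ u)   f g i j = trans (act-cong u (act-+ t f g) i j) (act-+ u (act t f) (act t g) i j)
  act-+ (⊟ t)     f g i j = trans (-‿cong (act-+ t f g i j)) (sym (-‿+-comm _ _))

  act-* : ∀ t k f i j → act t (λ i j → k * f i j) i j ≈ k * act t f i j
  act-* 𝐔 k f i j = solve 5 (λ k p b x y → p :* (k :* x) :+ b :* (k :* y) := k :* (p :* x :+ b :* y))
      refl k (q ^ i) (h * [ + i ]) _ _
  act-* 𝐕         k f i j = refl
  act-* (const l) k f i j = solve 3 (λ l k x → l :* (k :* x) := k :* (l :* x)) refl l k _
  act-* (t ⊞ u)   k f i j = trans (+-cong (act-* t k f i j) (act-* u k f i j)) (sym (*-distribˡ-+ k _ _))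
  act-* (t ⊠ u)   k f i j = trans (act-cong u (act-* t k f) i j) (act-* u k (act t f) i j)
  act-* (⊟ t)     k f i j = trans (-‿cong (act-* t k f i j)) (-‿distribʳ-* k _)

  act-𝐕^ᵀ : ∀ n f i j → act (𝐕 ^ᵀ n) f i j ≈ f (n ℕ.+ i) j
  act-𝐕^ᵀ zero    f i j = *-identityˡ _
  act-𝐕^ᵀ (suc n) f i j = act-𝐕^ᵀ n (act 𝐕 f) i j

  -- Subtracting q times the rule at `i` from the rule at `i + 1` cancels everything except `h * y`,
  -- because `[ i + 1 ] = q [ i ] + 1`.
  act-relation : ∀ f i j →
    act (𝐔 ⊠ 𝐕 ⊞ ⊟ (const q ⊠ (𝐕 ⊠ 𝐔))) f i j ≈ act (const h ⊠ 𝐕 ^ᵀ s) f i j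
  act-relation f i j = begin
    q ^ suc i * x + h * [ + suc i ] * y - (q ^ i * (q * x) + h * [ + i ] * (q * w))
      ≈⟨ +-congʳ (+-congˡ (*-congʳ (*-congˡ ([suc] i)))) ⟩
    q * q ^ i * x + h * (q * [ + i ] + 1#) * y - (q ^ i * (q * x) + h * [ + i ] * (q * w))
      -- At `i = 0` the two indices differ by one, but the coefficient contains `[ 0 ]`.
      ≈⟨ +-congˡ (-‿cong (+-congˡ (coalesce i))) ⟩
    q * q ^ i * x + h * (q * [ + i ] + 1#) * y - (q ^ i * (q * x) + h * [ + i ] * (q * y))
      ≈⟨ +-congʳ (solve 6 (λ q p h b x y → q :* p :* x :+ h :* (q :* b :+ con 1) :* y
             := h :* y :+ (p :* (q :* x) :+ h :* b :* (q :* y))) refl q (q ^ i) h [ + i ] x y) ⟩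
    h * y + r - r    ≈⟨ +-assoc _ _ _ ⟩
    h * y + (r - r)  ≈⟨ trans (+-congˡ (-‿inverseʳ r)) (+-identityʳ _) ⟩
    h * y            ≈⟨ *-congˡ (reflexive (≡.cong (λ n → f n j) (ℕₚ.+-comm i s))) ⟩
    h * f (s ℕ.+ i) j
      ≈⟨ act-𝐕^ᵀ s (λ i j → h * f i j) i j ⟨
    act (const h ⊠ 𝐕 ^ᵀ s) f i j ∎
    where
    x = f (suc i) (suc j)
    y = f (i ℕ.+ s) j
    w = f (suc (i ∸ 1 ℕ.+ s)) j
    r = q ^ i * (q * x) + h * [ + i ] * (q * y)
    coalesce : ∀ i → h * [ + i ] * (q * f (suc (i ∸ 1 ℕ.+ s)) j) ≈ h * [ + i ] * (q * f (i ℕ.+ s) j)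
    coalesce zero    = trans (*-congʳ h[0]≈0) (trans (zeroˡ _) (sym (trans (*-congʳ h[0]≈0) (zeroˡ _))))
      where h[0]≈0 = trans (*-congˡ [0]≈0) (zeroʳ h)
    coalesce (suc i) = refl

  act-respects-∼ : ∀ {t u} → t ∼ u → ∀ f i j → act t f i j ≈ act u f i j
  act-respects-∼ ∼-refl              f i j = refl
  act-respects-∼ (∼-sym p)           f i j = sym (act-respects-∼ p f i j)
  act-respects-∼ (∼-trans p p′)      f i j = trans (act-respects-∼ p f i j) (act-respects-∼ p′ f i j)
  act-respects-∼ (⊞-cong p p′)       f i j = +-cong (act-respects-∼ p f i j) (act-respects-∼ p′ f i j)
  act-respects-∼ (⊠-cong {x′ = x′} {y = y} p p′) f i j =
    trans (act-cong y (act-respects-∼ p f) i j) (act-respects-∼ p′ (act x′ f) i j)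
  act-respects-∼ (⊟-cong p)          f i j = -‿cong (act-respects-∼ p f i j)
  act-respects-∼ (⊞-assoc x y z)     f i j = +-assoc _ _ _
  act-respects-∼ (⊞-comm x y)        f i j = +-comm _ _
  act-respects-∼ (⊞-identityˡ x)     f i j = trans (+-congʳ (zeroˡ _)) (+-identityˡ _)
  act-respects-∼ (⊟-inverseˡ x)      f i j = trans (-‿inverseˡ _) (sym (zeroˡ _))
  act-respects-∼ (⊠-assoc x y z)     f i j = refl
  act-respects-∼ (⊠-identityˡ x)     f i j = act-cong x (λ i j → *-identityˡ _) i j
  act-respects-∼ (⊠-identityʳ x)     f i j = *-identityˡ _
  act-respects-∼ (distribˡ x y z)    f i j = refl
  act-respects-∼ (distribʳ x y z)    f i j = act-+ x (act y f) (act z f) i j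
  act-respects-∼ (const-cong k≈l)    f i j = *-congʳ k≈l
  act-respects-∼ (const-⊞ k l)       f i j = *-distribʳ-+ _ k l
  act-respects-∼ (const-⊠ k l)       f i j = solve 3 (λ k l x → k :* l :* x := l :* (k :* x)) refl k l _
  act-respects-∼ (const-⊟ k)         f i j = sym (-‿distribˡ-* k _)
  act-respects-∼ (const-central k x) f i j = act-* x k f i j
  act-respects-∼ relation            f i j = act-relation f i j

  act-𝐕^ : ∀ n f i j → act (𝐕 A.^ n) f i j ≈ f (n ℕ.+ i) j
  act-𝐕^ zero    f i j = *-identityˡ _
  act-𝐕^ (suc n) f i j = act-𝐕^ n (act 𝐕 f) i j

  -- At V-exponent 0 the contraction term carries `h [ 0 ] = 0`, so U only raises the second index.
  act-𝐔^ : ∀ n f j → act (𝐔 A.^ n) f 0 j ≈ f 0 (n ℕ.+ j)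
  act-𝐔^ zero    f j = *-identityˡ _
  act-𝐔^ (suc n) f j = begin
    act (𝐔 A.^ n) (act 𝐔 f) 0 j
      ≈⟨ act-𝐔^ n (act 𝐔 f) j ⟩
    1# * f 0 (suc (n ℕ.+ j)) + h * [ + 0 ] * f s (n ℕ.+ j)
      ≈⟨ +-cong (*-identityˡ _) (trans (*-congʳ (trans (*-congˡ [0]≈0) (zeroʳ h))) (zeroˡ _)) ⟩
    f 0 (suc (n ℕ.+ j)) + 0#
      ≈⟨ +-identityʳ _ ⟩
    f 0 (suc n ℕ.+ j) ∎

  δ : ℕ → ℕ → Carrier
  δ zero    zero    = 1#
  δ zero    (suc _) = 0#
  δ (suc _) zero    = 0#
  δ (suc k) (suc j) = δ k j

  δ-+ : ∀ a k j → δ (a ℕ.+ k) (a ℕ.+ j) ≡ δ k j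
  δ-+ zero    k j = ≡.refl
  δ-+ (suc a) k j = δ-+ a k j

  open FiniteSums +-commutativeMonoid

  ∑<-δ : ∀ {n k} → k < n → ∀ (f : ℕ → Carrier) → ∑< n (λ i → f i * δ k i) ≈ f k
  ∑<-δ {suc n} {zero} _ f =
    trans (+-cong (*-identityʳ _) (∑<-zero n λ i _ → zeroʳ (f (suc i)))) (+-identityʳ _)
  ∑<-δ {suc n} {suc k} (s≤s k<n) f =
    trans (+-cong (zeroʳ _) (∑<-δ k<n (f ∘ suc))) (+-identityˡ _)

  -- Applies `t` to the basis vector 1 = V^0 U^0 and adds up the coefficients of V^i U^k over all
  -- `i`.
  U-coefficient : ℕ → Term → Carrier
  U-coefficient k t = act t (λ _ j → δ k j) 0 0

  -- For negative `z` the monomial is 0 and retains no trace of `S`; the assumption on `S` fixes the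
  -- value there. This is the purpose of the condition `vanishing` on normal ordering coefficients.
  U-coefficient-monomial : ∀ k S z j → (z ℤ.< + 0 → S ≈ 0#) →
    U-coefficient k (const S ⊠ monomial z j) ≈ S * δ k j
  U-coefficient-monomial k S (+ e) j S≈0 = begin
    act (𝐔 A.^ j) (act (𝐕 A.^ e) f) 0 0 ≈⟨ act-𝐔^ j (act (𝐕 A.^ e) f) 0 ⟩
    act (𝐕 A.^ e) f 0 (j ℕ.+ 0)         ≈⟨ act-𝐕^ e f 0 (j ℕ.+ 0) ⟩
    S * δ k (j ℕ.+ 0)                   ≈⟨ *-congˡ (reflexive (≡.cong (δ k) (ℕₚ.+-identityʳ j))) ⟩
    S * δ k j                           ∎
    where
    f : ℕ → ℕ → Carrier
    f _ j = S * δ k j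
  U-coefficient-monomial k S -[1+ n ] j S≈0 =
    trans (zeroˡ _) (sym (trans (*-congʳ (S≈0 ℤ.-<+)) (zeroˡ _)))

  U-coefficient-expansion : ∀ a b (S : ℕ → Carrier) (z : ℕ → ℤ) →
    (∀ k → a ≤ k → k ≤ b → z k ℤ.< + 0 → S k ≈ 0#) →
    ∀ k → a ≤ k → k ≤ b →
    U-coefficient k (A.sumBetween a b (λ k → A.ι (S k) A.* monomial (z k) k)) ≈ S k
  U-coefficient-expansion a b S z S≈0 k a≤k k≤b = begin
    U-coefficient k (A.sumBetween a b (λ k → A.ι (S k) A.* monomial (z k) k))
      ≈⟨ AdditiveMaps.∑<-map A.+-commutativeMonoid +-commutativeMonoid (U-coefficient k)
           (zeroˡ _) (λ _ _ → refl) (suc b ∸ a) (λ i → A.ι (S (a ℕ.+ i)) A.* monomial (z (a ℕ.+ i)) (a ℕ.+ i)) ⟩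
    ∑< (suc b ∸ a) (λ i → U-coefficient k (const (S (a ℕ.+ i)) ⊠ monomial (z (a ℕ.+ i)) (a ℕ.+ i)))
      ≈⟨ ∑<-cong (suc b ∸ a) (λ i i< → trans
           (U-coefficient-monomial k (S (a ℕ.+ i)) (z (a ℕ.+ i)) (a ℕ.+ i)
             (S≈0 (a ℕ.+ i) (ℕₚ.m≤m+n a i) (in-range i i<)))
           (*-congˡ (reflexive (shift i)))) ⟩
    ∑< (suc b ∸ a) (λ i → S (a ℕ.+ i) * δ (k ∸ a) i)
      ≈⟨ ∑<-δ (ℕₚ.∸-monoˡ-< (s≤s k≤b) a≤k) (λ i → S (a ℕ.+ i)) ⟩
    S (a ℕ.+ (k ∸ a))
      ≈⟨ reflexive (≡.cong S (ℕₚ.m+[n∸m]≡n a≤k)) ⟩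
    S k ∎
    where
    in-range : ∀ i → i < suc b ∸ a → a ℕ.+ i ≤ b
    in-range i i< = ℕₚ.≤-pred (≡.subst (ℕ._≤ suc b) (≡.cong suc (ℕₚ.+-comm i a))
      (ℕₚ.m≤o∸n⇒m+n≤o (suc i) (ℕₚ.m≤n⇒m≤1+n (ℕₚ.≤-trans a≤k k≤b)) i<))
    shift : ∀ i → δ k (a ℕ.+ i) ≡ δ (k ∸ a) i
    shift i = ≡.trans (≡.cong (λ k → δ k (a ℕ.+ i)) (≡.sym (ℕₚ.m+[n∸m]≡n a≤k))) (δ-+ a (k ∸ a) i)

-- Existence, formula and uniqueness of the normal ordering coefficients.

module Coefficients {c ℓ₁ ℓ₂} (K : HeytingField c ℓ₁ ℓ₂)
  (q : HeytingField.Carrier K)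
  (q#0 : HeytingField._#_ K q (HeytingField.0# K))
  (q≟1 : HeytingField._≈_ K q (HeytingField.1# K) ⊎ HeytingField._#_ K q (HeytingField.1# K))
  (s : ℕ) (h : HeytingField.Carrier K) {m : ℕ} (𝐫 𝐬 : Vec ℕ (suc m))
  where

  open QNumberProperties K q q#0 q≟1
    using (commutativeRing; _^_; sumOfTotal; ΓProduct; ΓProduct-negative; ΓProduct-above; V-degree; coefficient)
  private
    module R = CommutativeRing commutativeRing
    module ΣR = FiniteSums R.+-commutativeMonoid
  open NormalOrdering commutativeRing s h q 𝐫 𝐬
  open Presented commutativeRing s h q
  open AlgebraProperties algebra hiding (_^_)
  private module A = AssociativeAlgebra algebra
  open Words algebra 𝐔 𝐕 using (H; monomial)
  open FiniteSums +-commutativeMonoid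
  open Sums +-commutativeMonoid using () renaming (sumOfTotal to sumOfTotalᴬ)
  open SetoidReasoning setoid

  𝐕^ᵀ≡𝐕^ : ∀ n → 𝐕 ^ᵀ n ≡ 𝐕 A.^ n
  𝐕^ᵀ≡𝐕^ zero    = ≡.refl
  𝐕^ᵀ≡𝐕^ (suc n) = ≡.cong (𝐕 ⊠_) (𝐕^ᵀ≡𝐕^ n)

  V-degree≡V-exponent : ∀ k 𝐣 → k ≤ sum 𝐬 → sum 𝐣 ≡ sum 𝐬 ∸ k → V-degree s 𝐫 𝐣 ≡ V-exponent k
  V-degree≡V-exponent k 𝐣 k≤ sum≡ =
    ≡.trans (≡.cong (λ t → + sum 𝐫 ℤ.+ t ℤ.* (+ s ℤ.- + 1)) total)
            (identity (+ sum 𝐫) (+ sum 𝐬 ℤ.- + k) (+ s))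
    where
    total : + sum 𝐣 ≡ + sum 𝐬 ℤ.- + k
    total = ≡.trans (≡.cong +_ sum≡) (≡.sym (≡.trans (ℤₚ.m-n≡m⊖n (sum 𝐬) k) (ℤₚ.⊖-≥ k≤)))
    identity : ∀ r t s → r ℤ.+ t ℤ.* (s ℤ.- + 1) ≡ r ℤ.- t ℤ.* (+ 1 ℤ.- s)
    identity = ℤ-Solver.solve-∀

  S : ℕ → R.Carrier
  S k = (h ^ (sum 𝐬 ∸ k)) R.* sumOfTotal m (sum 𝐬 ∸ k) (ΓProduct s 𝐫 𝐬)

  S-negative : ∀ k → k ≤ sum 𝐬 → V-exponent k ℤ.< + 0 → S k R.≈ R.0#
  S-negative k k≤ neg = R.trans
    (R.*-congˡ (ΣR.sumOfTotal-zero m (sum 𝐬 ∸ k) λ 𝐣 sum≡ →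
      ΓProduct-negative s 𝐫 𝐬 𝐣 (≡.subst (ℤ._< + 0) (≡.sym (V-degree≡V-exponent k 𝐣 k≤ sum≡)) neg)))
    (R.zeroʳ _)

  private
    summand : Vec ℕ m → Term
    summand 𝐣 = coefficient s h 𝐫 𝐬 𝐣 • monomial (V-degree s 𝐫 𝐣) (sum 𝐬 ∸ sum 𝐣)

  -- The exponents depend on `𝐣` only through its total, so one monomial factors out of the whole
  -- sum.
  sumOfTotal-summand : ∀ k → k ≤ sum 𝐬 →
    sumOfTotalᴬ m (sum 𝐬 ∸ k) summand ≈ S k • monomial (V-exponent k) k
  sumOfTotal-summand k k≤ = begin
    sumOfTotalᴬ m t summand
      ≈⟨ sumOfTotal-cong m t (λ 𝐣 sum≡ → •-cong
           (R.*-congʳ (R.reflexive (≡.cong (h ^_) sum≡)))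
           (reflexive (≡.cong₂ monomial (V-degree≡V-exponent k 𝐣 k≤ sum≡)
             (≡.trans (≡.cong (sum 𝐬 ∸_) sum≡) (ℕₚ.m∸[m∸n]≡n k≤))))) ⟩
    sumOfTotalᴬ m t (λ 𝐣 → ((h ^ t) R.* ΓProduct s 𝐫 𝐬 𝐣) • monomial (V-exponent k) k)
      ≈⟨ AdditiveMaps.sumOfTotal-map R.+-commutativeMonoid +-commutativeMonoid φ
           (•-zeroˡ _ (R.zeroʳ _)) (λ x y → trans (•-cong (R.distribˡ _ x y) refl) (•-+ _ _ _))
           m t (ΓProduct s 𝐫 𝐬) ⟨
    S k • monomial (V-exponent k) k ∎
    where
    t = sum 𝐬 ∸ k
    φ : R.Carrier → Term
    φ x = ((h ^ t) R.* x) • monomial (V-exponent k) k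

  S-areCoefficients : AreNormalOrderingCoefficients S
  S-areCoefficients = record
    { expansion = expansion
    ; vanishing = λ k _ → S-negative k
    }
    where
    a = head 𝐬
    T = sum (tail 𝐬)
    sum≡ : sum 𝐬 ≡ a ℕ.+ T
    sum≡ = head+tail 𝐬
      where
      head+tail : ∀ {n} (xs : Vec ℕ (suc n)) → sum xs ≡ head xs ℕ.+ sum (tail xs)
      head+tail (x ∷ xs) = ≡.refl
    count : suc T ≡ suc (sum 𝐬) ∸ a
    count = ≡.sym (≡.trans (≡.cong (λ n → suc n ∸ a) sum≡)
              (≡.trans (≡.cong (_∸ a) (≡.sym (ℕₚ.+-suc a T))) (ℕₚ.m+n∸m≡n a (suc T))))
    term : ℕ → Term
    term k = S k • monomial (V-exponent k) k
    relationᴬ : 𝐔 ⊠ 𝐕 ⊞ ⊟ (const q ⊠ (𝐕 ⊠ 𝐔)) ∼ const h ⊠ 𝐕 A.^ s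
    relationᴬ = ≡.subst (λ x → _ ∼ const h ⊠ x) (𝐕^ᵀ≡𝐕^ s) relation
    expansion : H 𝐫 𝐬 ≈ A.sumBetween a (sum 𝐬) term
    expansion = begin
      H 𝐫 𝐬
        ≈⟨ NormalOrder.H-expansion K q q#0 q≟1 s h algebra 𝐔 𝐕 relationᴬ 𝐫 𝐬 ⟩
      A.nestedSum (tail 𝐬) summand
        ≈⟨ nestedSum-by-total (tail 𝐬) summand (λ 𝐣 i lt → •-zeroˡ _
             (R.trans (R.*-congˡ (ΓProduct-above s 𝐫 𝐬 𝐣 i lt)) (R.zeroʳ _))) ⟩
      ∑< (suc T) (λ t → sumOfTotalᴬ m t summand)
        -- The total t and the exponent k = |𝐬| - t of U run in opposite directions; the largest
        -- total `T` corresponds to k = s₁.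
        ≈⟨ ∑<-reverse (suc T) (λ t → sumOfTotalᴬ m t summand) ⟩
      ∑< (suc T) (λ i → sumOfTotalᴬ m (T ∸ i) summand)
        ≈⟨ ∑<-cong (suc T) (λ i i<1+T → trans
             (reflexive (≡.cong (λ t → sumOfTotalᴬ m t summand) (complement i)))
             (sumOfTotal-summand (a ℕ.+ i) (in-range i (ℕₚ.≤-pred i<1+T)))) ⟩
      ∑< (suc T) (λ i → term (a ℕ.+ i))
        ≈⟨ reflexive (≡.cong (λ n → ∑< n (λ i → term (a ℕ.+ i))) count) ⟩
      A.sumBetween a (sum 𝐬) term ∎
      where
      complement : ∀ i → T ∸ i ≡ sum 𝐬 ∸ (a ℕ.+ i)
      complement i = ≡.sym (≡.trans (≡.cong (_∸ (a ℕ.+ i)) sum≡) (ℕₚ.[m+n]∸[m+o]≡n∸o a T i))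
      in-range : ∀ i → i ≤ T → a ℕ.+ i ≤ sum 𝐬
      in-range i i≤T = ≡.subst (a ℕ.+ i ≤_) (≡.sym sum≡) (ℕₚ.+-monoʳ-≤ a i≤T)

  -- Both expansions represent the same element, and `U-coefficient k` is well defined on the
  -- quotient by `act-respects-∼`; its values on the two expansions are the two coefficients.
  coefficients-unique : ∀ {S₁ S₂} → AreNormalOrderingCoefficients S₁ → AreNormalOrderingCoefficients S₂ →
    ∀ k → head 𝐬 ≤ k → k ≤ sum 𝐬 → S₁ k R.≈ S₂ k
  coefficients-unique {S₁} {S₂} C₁ C₂ k ≤k k≤ =
    R.trans (R.sym (value C₁)) (R.trans
      (act-respects-∼ (trans (sym (expansion C₁)) (expansion C₂)) _ 0 0)
      (value C₂))
    where
    open AreNormalOrderingCoefficients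
    open DualAction K q q#0 q≟1 s h using (U-coefficient; U-coefficient-expansion; act-respects-∼)
    value : ∀ {S} → AreNormalOrderingCoefficients S →
      U-coefficient k (A.sumBetween (head 𝐬) (sum 𝐬) (λ k → S k • monomial (V-exponent k) k)) R.≈ S k
    value {S} C = U-coefficient-expansion (head 𝐬) (sum 𝐬) S V-exponent (vanishing C) k ≤k k≤

theorem10 :
    ∀ {c ℓ₁ ℓ₂ a ℓ} (K : HeytingField c ℓ₁ ℓ₂) →
    let module K = HeytingField K in
    (s : ℕ) (h q : K.Carrier) → h K.# K.0# →
    (q#0 : q K.# K.0#) (q≟1 : q K.≈ K.1# ⊎ q K.# K.1#) →
    {m : ℕ} (𝐫 𝐬 : Vec ℕ (suc m)) →
    let open QNumbers K q q#0 q≟1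
        open NormalOrdering commutativeRing s h q 𝐫 𝐬
    in
    (∀ (A : AssociativeAlgebra commutativeRing a ℓ) →
      let module A = AssociativeAlgebra A in
      (U V : A.Carrier) →
      let open Words A U V in
      U A.* V A.- A.ι q A.* (V A.* U) A.≈ A.ι h A.* V A.^ s →
      H 𝐫 𝐬 A.≈ A.nestedSum (tail 𝐬) (λ 𝐣 →
        A.ι (coefficient s h 𝐫 𝐬 𝐣) A.* monomial (V-degree s 𝐫 𝐣) (sum 𝐬 ∸ sum 𝐣)))
    × (∀ 𝐣 → Pointwise _≤_ 𝐣 (tail 𝐬) → V-degree s 𝐫 𝐣 ℤ.< + 0 →
        coefficient s h 𝐫 𝐬 𝐣 K.≈ K.0#)
    × ∃ AreNormalOrderingCoefficients
    × (∀ S → AreNormalOrderingCoefficients S →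
        ∀ k → head 𝐬 ≤ k → k ≤ sum 𝐬 →
        S k K.≈ h ^ (sum 𝐬 ∸ k) K.* sumOfTotal m (sum 𝐬 ∸ k) (ΓProduct s 𝐫 𝐬))
theorem10 K s h q h#0 q#0 q≟1 𝐫 𝐬 =
    (λ A U V relation → NormalOrder.H-expansion K q q#0 q≟1 s h A U V relation 𝐫 𝐬)
  , (λ 𝐣 _ neg → R.trans (R.*-congˡ (ΓProduct-negative s 𝐫 𝐬 𝐣 neg)) (R.zeroʳ _))
  , (S , S-areCoefficients)
  , (λ S′ areCoefficients → coefficients-unique areCoefficients S-areCoefficients)
  where
  open QNumberProperties K q q#0 q≟1 using (commutativeRing; ΓProduct-negative)
  open Coefficients K q q#0 q≟1 s h 𝐫 𝐬
  module R = CommutativeRing commutativeRing
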